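{- For every integer $n\ge 2$, $$t_2^{\mathrm{match}}(n)\ge\frac18\left(\frac n4\right)^{3/5}.$$
   Context: An ordered matching of size $n$ is a graph on a linearly ordered vertex set of $2n$ vertices consisting of $n$ pairwise vertex-disjoint edges. Two ordered graphs on $m$ vertices $v_1<\cdots<v_m$ and $w_1<\cdots<w_m$ are order-isomorphic if for all $i<j$, $v_iv_j$ is an edge of the first if and only if $w_iw_j$ is an edge of the second. $2$-twins (twins) in an ordered matching $M$ are two disjoint, order-isomorphic sub-matchings $M_1,M_2$ of $M$ (sub-matchings inherit the vertex order of $M$); their size is $|M_1|=|M_2|$, the number of edges in just one of them. $t_2(M)$ denotes the maximum size of $2$-twins in $M$, and $t_2^{\mathrm{match}}(n)$ is the minimum of $t_2(M)$ over all ordered matchings $M$ of size $n$ on the vertex set $\{1,\dots,2n\}$. -}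

module Defs where

open import Data.Empty using (⊥-elim)
open import Data.Fin using (Fin; zero; suc; _<_; combine)
open import Data.Fin.Properties as Fin
  using (_≟_; _<?_; any?; all?; injective⇒≤; combine-monoˡ-<; combine-injectiveʳ)
open import Data.Fin.Subset using (Subset; _∈_; _∩_; Empty; ∣_∣; ⊥)
open import Data.Fin.Subset.Properties
  using (_∈?_; anySubset?; nonempty?; ∣p∣≤n; ∉⊥; ∣⊥∣≡0; x∈p∩q⁻)
open import Data.Nat as ℕ using (ℕ; zero; suc; _*_; _≤_; z≤n; s≤s; s≤s⁻¹)
import Data.Nat.Properties as ℕ
open import Data.Product using (Σ; ∃; ∃-syntax; _×_; _,_; proj₁; proj₂)
open import Data.Sum using (_⊎_; inj₁; inj₂)
open import Data.Vec using (Vec; []; _∷_; lookup; tabulate)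
open import Data.Vec.Properties using (lookup∘tabulate)
open import Function.Base using (_∘_)
open import Function.Bundles using (_⇔_; mk⇔; Equivalence)
open import Relation.Binary.Definitions using (tri<; tri≈; tri>)
open import Relation.Binary.PropositionalEquality
  using (_≡_; _≢_; refl; sym; trans; subst)
open import Relation.Nullary using (¬_; Dec; yes; no; ¬?)
open import Relation.Nullary.Decidable using (map′; _×-dec_; _⊎-dec_; _→-dec_)

private
  variable
    m n N : ℕ

-- The vertices form a subset of Fin N and carry the order of Fin N.
record OrderedGraph (N : ℕ) : Set₁ where
  field
    Vertex : Fin N → Set
    Adj    : Fin N → Fin N → Set

open OrderedGraph public

StrictlyIncreasing : Vec (Fin N) m → Set
StrictlyIncreasing v = ∀ i j → i < j → lookup v i < lookup v j

-- v lists the vertices of G as v₁ < ⋯ < vₘ.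
Enumerates : OrderedGraph N → Vec (Fin N) m → Set
Enumerates G v =
  StrictlyIncreasing v × (∀ x → Vertex G x ⇔ (∃[ i ] lookup v i ≡ x))

OrderIsomorphic : OrderedGraph N → OrderedGraph N → Set
OrderIsomorphic {N} G H =
  ∃[ m ] Σ (Vec (Fin N) m) λ v → Σ (Vec (Fin N) m) λ w →
    Enumerates G v × Enumerates H w ×
    (∀ i j → i < j →
      Adj G (lookup v i) (lookup v j) ⇔ Adj H (lookup w i) (lookup w j))

-- The edge {x , y} with x < y is stored as (x , y).
Edge : ℕ → Set
Edge N = Fin N × Fin N

_∈ᵉ_ : Fin N → Edge N → Set
x ∈ᵉ (a , b) = x ≡ a ⊎ x ≡ b

Joins : Edge N → Fin N → Fin N → Set
Joins (a , b) x y = (x ≡ a × y ≡ b) ⊎ (x ≡ b × y ≡ a)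

DisjointEdges : Edge N → Edge N → Set
DisjointEdges e f = ∀ x → ¬ (x ∈ᵉ e × x ∈ᵉ f)

IsMatching : Vec (Edge N) n → Set
IsMatching es =
  (∀ i → proj₁ (lookup es i) < proj₂ (lookup es i)) ×
  (∀ i j → i ≢ j → DisjointEdges (lookup es i) (lookup es j))

-- The n disjoint edges use 2n vertices, hence cover all of Fin (2 * n).
record OrderedMatching (n : ℕ) : Set where
  constructor mkMatching
  field
    edges      : Vec (Edge (2 * n)) n
    isMatching : IsMatching edges

open OrderedMatching public

-- A sub-matching of M is given by a set S of (indices of) edges of M; its
-- vertices are the endpoints of those edges.
subGraph : (M : OrderedMatching n) → Subset n → OrderedGraph (2 * n)
subGraph M S = record
  { Vertex = λ x → ∃[ e ] e ∈ S × x ∈ᵉ lookup (edges M) e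
  ; Adj    = λ x y → ∃[ e ] e ∈ S × Joins (lookup (edges M) e) x y
  }

-- As the edges of M share no vertices, edge-disjoint sub-matchings are also
-- vertex-disjoint.
HasTwinsOfSize : OrderedMatching n → ℕ → Set
HasTwinsOfSize {n} M k =
  Σ (Subset n) λ S → Σ (Subset n) λ T →
    Empty (S ∩ T) × ∣ S ∣ ≡ k × ∣ T ∣ ≡ k ×
    OrderIsomorphic (subGraph M S) (subGraph M T)

IsMaximum : (ℕ → Set) → ℕ → Set
IsMaximum P m = P m × (∀ k → P k → k ≤ m)

IsMinimum : (ℕ → Set) → ℕ → Set
IsMinimum P m = P m × (∀ k → P k → m ≤ k)

-- The private part shows, by exhaustive search, that the maximum defining t₂
-- and the minimum defining t₂ᵐᵃᵗᶜʰ exist.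
private

  Searchable : Set → Set₁
  Searchable A = {P : A → Set} → (∀ x → Dec (P x)) → Dec (∃ P)

  searchEdge : Searchable (Edge N)
  searchEdge P? = map′ (λ (a , b , p) → (a , b) , p) (λ ((a , b) , p) → a , b , p)
    (any? λ a → any? λ b → P? (a , b))

  searchVec : {A : Set} → Searchable A → Searchable (Vec A m)
  searchVec {zero}  s P? = map′ (λ p → [] , p) (λ { ([] , p) → p }) (P? [])
  searchVec {suc m} s P? =
    map′ (λ (x , xs , p) → (x ∷ xs) , p) (λ { ((x ∷ xs) , p) → x , xs , p })
      (s λ x → searchVec s λ xs → P? (x ∷ xs))

  _⇔-dec_ : {A B : Set} → Dec A → Dec B → Dec (A ⇔ B)
  a? ⇔-dec b? = map′ (λ (f , g) → mk⇔ f g)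
    (λ e → Equivalence.to e , Equivalence.from e) ((a? →-dec b?) ×-dec (b? →-dec a?))

  searchBounded : {P : ℕ → Set} (b : ℕ) → (∀ k → P k → k ≤ b) →
                  (∀ k → Dec (P k)) → Dec (∃ P)
  searchBounded b bd P? = map′ (λ (k , _ , p) → k , p) (λ (k , p) → k , s≤s (bd k p) , p)
    (ℕ.anyUpTo? P? (suc b))

  maximum : {P : ℕ → Set} → (∀ k → Dec (P k)) → (b : ℕ) → (∀ k → P k → k ≤ b) →
            ∃ P → ∃ (IsMaximum P)
  maximum P? b bd (k , p) with P? b
  ... | yes q = b , q , bd
  maximum P? zero bd (k , p) | no ¬q with bd k p
  ... | z≤n = ⊥-elim (¬q p)
  maximum {P} P? (suc b) bd w | no ¬q = maximum P? b bd′ w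
    where
    bd′ : ∀ k → P k → k ≤ b
    bd′ k p = s≤s⁻¹ (ℕ.≤∧≢⇒< (bd k p) λ { refl → ¬q p })

  minimum : {P : ℕ → Set} → (∀ k → Dec (P k)) → ∃ P → ∃ (IsMinimum P)
  minimum {P} P? (k , p) = go P? k p
    where
    go : {P : ℕ → Set} → (∀ k → Dec (P k)) → ∀ k → P k → ∃ (IsMinimum P)
    go P? k p with P? zero
    ... | yes q = zero , q , λ _ _ → z≤n
    go P? zero p | no ¬q = ⊥-elim (¬q p)
    go {P} P? (suc k) p | no ¬q with go (P? ∘ suc) k p
    ... | m , q , least = suc m , q , least′
      where
      least′ : ∀ j → P j → suc m ≤ j
      least′ zero    r = ⊥-elim (¬q r)
      least′ (suc j) r = s≤s (least j r)

  DecGraph : OrderedGraph N → Set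
  DecGraph G = (∀ x → Dec (Vertex G x)) × (∀ x y → Dec (Adj G x y))

  enumerates? : (G : OrderedGraph N) → DecGraph G → (v : Vec (Fin N) m) → Dec (Enumerates G v)
  enumerates? G (V? , _) v =
    all? (λ i → all? λ j → (i <? j) →-dec (lookup v i <? lookup v j))
    ×-dec all? (λ x → V? x ⇔-dec any? λ i → lookup v i ≟ x)

  increasing⇒≤ : (v : Vec (Fin N) m) → StrictlyIncreasing v → m ≤ N
  increasing⇒≤ v inc = injective⇒≤ {f = lookup v} inj
    where
    inj : ∀ {i j} → lookup v i ≡ lookup v j → i ≡ j
    inj {i} {j} eq with Fin.<-cmp i j
    ... | tri< i<j _ _ = ⊥-elim (Fin.<-irrefl eq (inc i j i<j))
    ... | tri≈ _ i≡j _ = i≡j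
    ... | tri> _ _ j<i = ⊥-elim (Fin.<-irrefl (sym eq) (inc j i j<i))

  orderIsomorphic? : (G H : OrderedGraph N) → DecGraph G → DecGraph H →
                     Dec (OrderIsomorphic G H)
  orderIsomorphic? {N} G H G? H? =
    searchBounded N (λ _ (v , _ , (inc , _) , _) → increasing⇒≤ v inc)
      λ m → searchVec any? λ v → searchVec any? λ w →
        enumerates? G G? v ×-dec enumerates? H H? w ×-dec
        all? λ i → all? λ j → (i <? j) →-dec (proj₂ G? _ _ ⇔-dec proj₂ H? _ _)

  ∈ᵉ? : (x : Fin N) (e : Edge N) → Dec (x ∈ᵉ e)
  ∈ᵉ? x (a , b) = (x ≟ a) ⊎-dec (x ≟ b)

  joins? : (e : Edge N) (x y : Fin N) → Dec (Joins e x y)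
  joins? (a , b) x y = ((x ≟ a) ×-dec (y ≟ b)) ⊎-dec ((x ≟ b) ×-dec (y ≟ a))

  subGraph? : (M : OrderedMatching n) (S : Subset n) → DecGraph (subGraph M S)
  subGraph? M S =
    (λ x → any? λ e → (e ∈? S) ×-dec ∈ᵉ? x (lookup (edges M) e)) ,
    (λ x y → any? λ e → (e ∈? S) ×-dec joins? (lookup (edges M) e) x y)

  hasTwinsOfSize? : (M : OrderedMatching n) (k : ℕ) → Dec (HasTwinsOfSize M k)
  hasTwinsOfSize? M k = anySubset? λ S → anySubset? λ T →
    ¬? (nonempty? (S ∩ T)) ×-dec (∣ S ∣ ℕ.≟ k) ×-dec (∣ T ∣ ℕ.≟ k) ×-dec
    orderIsomorphic? _ _ (subGraph? M S) (subGraph? M T)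

  twins-bounded : (M : OrderedMatching n) → ∀ k → HasTwinsOfSize M k → k ≤ n
  twins-bounded M k (S , _ , _ , refl , _) = ∣p∣≤n S

  emptyTwins : (M : OrderedMatching n) → HasTwinsOfSize M 0
  emptyTwins {n} M =
    ⊥ , ⊥ , (λ (x , x∈) → ∉⊥ (proj₁ (x∈p∩q⁻ ⊥ ⊥ x∈))) , ∣⊥∣≡0 n , ∣⊥∣≡0 n ,
    0 , [] , [] , enum , enum , λ ()
    where
    enum : Enumerates (subGraph M ⊥) []
    enum = (λ ()) , λ x → mk⇔ (λ (e , e∈ , _) → ⊥-elim (∉⊥ e∈)) λ ()

  isMatching? : (es : Vec (Edge N) n) → Dec (IsMatching es)
  isMatching? es =
    all? (λ i → proj₁ (lookup es i) <? proj₂ (lookup es i)) ×-dec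
    all? (λ i → all? λ j → ¬? (i ≟ j) →-dec
      all? λ x → ¬? (∈ᵉ? x (lookup es i) ×-dec ∈ᵉ? x (lookup es j)))

  -- The matching with edges {i , n + i}.
  someMatching : ∀ n → OrderedMatching n
  someMatching n = mkMatching (tabulate e) (ordered , disjoint)
    where
    e : Fin n → Edge (2 * n)
    e i = combine {2} zero i , combine {2} (suc zero) i

    ordered : ∀ i → proj₁ (lookup (tabulate e) i) < proj₂ (lookup (tabulate e) i)
    ordered i rewrite lookup∘tabulate e i =
      combine-monoˡ-< {2} {n} {zero} {suc zero} i i (s≤s z≤n)

    index : ∀ {x} i → x ∈ᵉ e i → ∃[ c ] x ≡ combine {2} c i
    index i (inj₁ p) = zero , p
    index i (inj₂ p) = suc zero , p

    disjoint : ∀ i j → i ≢ j → DisjointEdges (lookup (tabulate e) i) (lookup (tabulate e) j)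
    disjoint i j i≢j x (p , q)
      with index i (subst (x ∈ᵉ_) (lookup∘tabulate e i) p)
         | index j (subst (x ∈ᵉ_) (lookup∘tabulate e j) q)
    ... | c , x≡ | d , x≡′ = i≢j (combine-injectiveʳ c i d j (trans (sym x≡) x≡′))

-- Only the specification matters; the search should not be unfolded.
abstract
  t₂-exists : (M : OrderedMatching n) → ∃ (IsMaximum (HasTwinsOfSize M))
  t₂-exists {n} M =
    maximum (hasTwinsOfSize? M) n (twins-bounded M) (0 , emptyTwins M)

t₂ : OrderedMatching n → ℕ
t₂ M = proj₁ (t₂-exists M)

t₂-isMaximum : (M : OrderedMatching n) → IsMaximum (HasTwinsOfSize M) (t₂ M)
t₂-isMaximum M = proj₂ (t₂-exists M)

private

  t₂-unique : (M M′ : OrderedMatching n) → edges M ≡ edges M′ → t₂ M ≡ t₂ M′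
  t₂-unique M@(mkMatching _ _) M′@(mkMatching _ _) refl = ℕ.≤-antisym
    (proj₂ (t₂-isMaximum M′) _ (proj₁ (t₂-isMaximum M)))
    (proj₂ (t₂-isMaximum M) _ (proj₁ (t₂-isMaximum M′)))

  t₂-value? : ∀ n k → Dec (Σ (OrderedMatching n) λ M → t₂ M ≡ k)
  t₂-value? n k = map′ (λ (es , p , eq) → mkMatching es p , eq)
                       (λ (mkMatching es p , eq) → es , p , eq)
                       (searchVec searchEdge dec)
    where
    dec : ∀ es → Dec (Σ (IsMatching es) λ p → t₂ (mkMatching es p) ≡ k)
    dec es with isMatching? es
    ... | no ¬p = no (¬p ∘ proj₁)
    ... | yes p with t₂ (mkMatching es p) ℕ.≟ k
    ...   | yes eq = yes (p , eq)
    ...   | no ¬eq = no λ (p′ , eq) →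
      ¬eq (trans (t₂-unique (mkMatching es p) (mkMatching es p′) refl) eq)

abstract
  t₂ᵐᵃᵗᶜʰ-exists : ∀ n → ∃ (IsMinimum (λ k → Σ (OrderedMatching n) λ M → t₂ M ≡ k))
  t₂ᵐᵃᵗᶜʰ-exists n = minimum (t₂-value? n) (t₂ (someMatching n) , someMatching n , refl)

t₂ᵐᵃᵗᶜʰ : ℕ → ℕ
t₂ᵐᵃᵗᶜʰ n = proj₁ (t₂ᵐᵃᵗᶜʰ-exists n)

t₂ᵐᵃᵗᶜʰ-isMinimum : ∀ n → IsMinimum (λ k → Σ (OrderedMatching n) λ M → t₂ M ≡ k) (t₂ᵐᵃᵗᶜʰ n)
t₂ᵐᵃᵗᶜʰ-isMinimum n = proj₂ (t₂ᵐᵃᵗᶜʰ-exists n)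

{-# OPTIONS --safe #-}
module Submission where

-- At some cut of the vertex line, either a third of the edges lie on each side,
-- and twins of the two sides are joined, or a third of the edges pass over the
-- cut.  The latter are ordered by their left endpoints, and their right
-- endpoints make them a permutation, for which we follow Bukh and Rudenko.
-- Twins are pairs (x , y) whose value intervals are disjoint.  The points are
-- read in blocks of consecutive positions; in a block, points of nearby values
-- are grouped into triples, and of the three orders in which a set of triples
-- lists its first, second and third points, two have a common subsequence of
-- length the cube root of the number of triples.  The value intervals of the
-- pairs thus obtained are then closed to the later blocks.

open import Data.Empty using (⊥-elim)
open import Data.Fin as Fin using (Fin; toℕ)
open import Data.Fin.Properties using (toℕ-injective; toℕ<n)
open import Data.Fin.Subset as Subset using (Subset; ∣_∣; ⊥; _∩_; Empty)
open import Data.Fin.Subset.Properties using (∉⊥; ∣⊥∣≡0; x∈p∩q⁻)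
open import Data.List as List using (List; []; _∷_; _++_; allFin; drop; filter; length; map; take)
open import Data.List.Membership.Propositional using (_∈_; find)
open import Data.List.Membership.Propositional.Properties
  using (∈-filter⁻; ∈-lookup; ∈-map⁺; ∈-map⁻)
open import Data.List.Properties
  using (filter-all; filter-none; length-filter; length-map; length-take; length-drop;
         length-++; length-tabulate)
open import Data.List.Relation.Binary.Permutation.Propositional as Perm using (_↭_; ↭-sym)
open import Data.List.Relation.Binary.Permutation.Propositional.Properties
  using (All-resp-↭; ∈-resp-↭; ↭-length)
open import Data.List.Relation.Binary.Sublist.Propositional
  using (_⊆_; []; _∷_; _∷ʳ_; ⊆-refl; ⊆-trans)
open import Data.List.Relation.Binary.Sublist.Propositional.Properties
  using (All-resp-⊆; Any-resp-⊆; filter-⊆; drop-⊆)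
open import Data.List.Relation.Unary.All as All using (All; []; _∷_)
open import Data.List.Relation.Unary.AllPairs as AllPairs using (AllPairs; []; _∷_)
open import Data.List.Relation.Unary.Any as Any using (Any; here; there)
open import Data.List.Relation.Unary.Any.Properties using (lookup-index)
open import Data.Nat
  using (ℕ; zero; suc; _+_; _*_; _∸_; _^_; _≤_; _<_; _≤?_; _<?_; >-nonZero; z≤n; s≤s;
         ⌊_/2⌋; NonZero)
open import Data.Nat.DivMod using (_/_; _%_; m/n*n≤m; m%n<n; m≡m%n+[m/n]*n; /-monoˡ-≤)
open import Data.Nat.Induction using (<-rec)
open import Data.Nat.Properties
open import Data.Nat.Tactic.RingSolver using (solve-∀)
open import Data.Product using (∃-syntax; _×_; _,_; proj₁; proj₂)
open import Data.Sum using (_⊎_; inj₁; inj₂; swap)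
open import Data.Unit using (tt)
open import Data.Vec as Vec using (Vec; _[_]≔_)
open import Data.Vec.Properties
  using ([]≔-updates; []≔-minimal; lookup∘update′; lookup⇒[]=; []=⇒lookup; lookup∘tabulate)
open import Function.Bundles using (mk⇔)
open import Relation.Binary.Definitions using (tri<; tri≈; tri>)
open import Relation.Binary.PropositionalEquality using (_≡_; _≢_; refl; sym; trans; cong; subst)
open import Relation.Nullary using (¬_; Dec; yes; no; ¬?)
open import Relation.Nullary.Decidable using (_×-dec_)
open import Relation.Unary using (Decidable)
import Data.List.Relation.Unary.All.Properties as All
import Data.List.Relation.Unary.AllPairs.Properties as AllPairs
import Data.List.Relation.Unary.Unique.Propositional.Properties as Unique
open import Defs

-- Pairwise relations on lists, sorting and counting.

AllPairs-resp-⊆ : ∀ {A : Set} {R : A → A → Set} {xs ys} → xs ⊆ ys → AllPairs R ys → AllPairs R xs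
AllPairs-resp-⊆ []         []       = []
AllPairs-resp-⊆ (_ ∷ʳ τ)   (_ ∷ rs) = AllPairs-resp-⊆ τ rs
AllPairs-resp-⊆ (refl ∷ τ) (r ∷ rs) = All-resp-⊆ τ r ∷ AllPairs-resp-⊆ τ rs

AllPairs-zip : ∀ {A : Set} {R S T : A → A → Set} → (∀ {x y} → R x y → S x y → T x y) →
               ∀ {xs} → AllPairs R xs → AllPairs S xs → AllPairs T xs
AllPairs-zip f []       []       = []
AllPairs-zip f (r ∷ rs) (s ∷ ss) =
  All.zipWith (λ (r , s) → f r s) (r , s) ∷ AllPairs-zip f rs ss

AllPairs-members : ∀ {A : Set} {P : A → Set} {R S : A → A → Set} →
                   (∀ {x y} → P x → P y → R x y → S x y) →
                   ∀ {xs} → All P xs → AllPairs R xs → AllPairs S xs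
AllPairs-members f []       []       = []
AllPairs-members f (p ∷ ps) (r ∷ rs) =
  All.zipWith (λ (q , r) → f p q r) (ps , r) ∷ AllPairs-members f ps rs

AllPairs-∈ : ∀ {A : Set} {R : A → A → Set} → (∀ {x y} → R x y → R y x) →
             ∀ {xs x y} → AllPairs R xs → x ∈ xs → y ∈ xs → x ≡ y ⊎ R x y
AllPairs-∈ R-sym (_ ∷ _)  (here refl) (here refl) = inj₁ refl
AllPairs-∈ R-sym (r ∷ _)  (here refl) (there y∈)  = inj₂ (All.lookup r y∈)
AllPairs-∈ R-sym (r ∷ _)  (there x∈)  (here refl) = inj₂ (R-sym (All.lookup r x∈))
AllPairs-∈ R-sym (_ ∷ rs) (there x∈)  (there y∈)  = AllPairs-∈ R-sym rs x∈ y∈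

module _ {A : Set} {R : A → A → Set} (R-trans : ∀ {x y z} → R x y → R y z → R x z) where

  insert-sorted : ∀ x {ys} → AllPairs R ys → All (λ y → R x y ⊎ R y x) ys →
                  ∃[ zs ] zs ↭ x ∷ ys × AllPairs R zs
  insert-sorted x []       []             = x ∷ [] , Perm.refl , [] ∷ []
  insert-sorted x (r ∷ rs) (inj₁ xy ∷ cs) =
    _ , Perm.refl , (xy ∷ All.map (R-trans xy) r) ∷ r ∷ rs
  insert-sorted x (_∷_ {y} r rs) (inj₂ yx ∷ cs) with insert-sorted x rs cs
  ... | zs , zs↭ , szs =
    y ∷ zs , Perm.trans (Perm.prep y zs↭) (Perm.swap y x Perm.refl) ,
    All-resp-↭ (↭-sym zs↭) (yx ∷ r) ∷ szs

  -- Insertion sort without a decision procedure: the proofs of comparability tell which of two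
  -- elements comes first. It sorts by value, by position, and pairs of vertices by both coordinates
  -- at once.
  linearise : ∀ {xs} → AllPairs (λ x y → R x y ⊎ R y x) xs → ∃[ ys ] ys ↭ xs × AllPairs R ys
  linearise []                   = [] , Perm.refl , []
  linearise (_∷_ {x} c cs) with linearise cs
  ... | ys , ys↭ , sys with insert-sorted x sys (All-resp-↭ (↭-sym ys↭) c)
  ... | zs , zs↭ , szs = zs , Perm.trans zs↭ (Perm.prep x ys↭) , szs

length-filter-¬ : ∀ {A : Set} {P : A → Set} (P? : Decidable P) xs →
                  length (filter P? xs) + length (filter (λ x → ¬? (P? x)) xs) ≡ length xs
length-filter-¬ P? []       = refl
length-filter-¬ P? (x ∷ xs) with P? x
... | yes _ = cong suc (length-filter-¬ P? xs)
... | no  _ = trans (+-suc _ _) (cong suc (length-filter-¬ P? xs))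

length-filter-⊎ : ∀ {A : Set} {P Q R : A → Set} (P? : Decidable P) (Q? : Decidable Q) (R? : Decidable R) →
                  (∀ {x} → P x → ¬ Q x) → (∀ {x} → P x → R x) → (∀ {x} → Q x → R x) → ∀ xs →
                  length (filter P? xs) + length (filter Q? xs) ≤ length (filter R? xs)
length-filter-⊎ P? Q? R? PQ PR QR []       = z≤n
length-filter-⊎ P? Q? R? PQ PR QR (x ∷ xs)
  with length-filter-⊎ P? Q? R? PQ PR QR xs | P? x | Q? x | R? x
... | ih | yes p | yes q | _     = ⊥-elim (PQ p q)
... | ih | yes p | no  _ | yes _ = s≤s ih
... | ih | yes p | no  _ | no ¬r = ⊥-elim (¬r (PR p))
... | ih | no  _ | yes q | yes _ = ≤-trans (≤-reflexive (+-suc _ _)) (s≤s ih)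
... | ih | no  _ | yes q | no ¬r = ⊥-elim (¬r (QR q))
... | ih | no  _ | no  _ | yes _ = m≤n⇒m≤1+n ih
... | ih | no  _ | no  _ | no  _ = ih

length-filter-mono-⊆ : ∀ {A : Set} {P : A → Set} (P? : Decidable P) {xs ys} → xs ⊆ ys →
                       length (filter P? xs) ≤ length (filter P? ys)
length-filter-mono-⊆ P? []           = z≤n
length-filter-mono-⊆ P? (y ∷ʳ τ) with P? y
... | yes _ = m≤n⇒m≤1+n (length-filter-mono-⊆ P? τ)
... | no  _ = length-filter-mono-⊆ P? τ
length-filter-mono-⊆ P? (_∷_ {x} refl τ) with P? x
... | yes _ = s≤s (length-filter-mono-⊆ P? τ)
... | no  _ = length-filter-mono-⊆ P? τ

-- Chains, antichains and agreeing orders.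

-- Mirsky's theorem: the minimal elements form an antichain, and a chain among
-- the remaining elements extends downwards by one.
chain-or-antichain : ∀ {A : Set} {R : A → A → Set} → (∀ x y → Dec (R x y)) →
  (∀ {x y z} → R x y → R y z → R x z) → ∀ m w (xs : List A) → m * w < length xs →
  (∃[ ys ] m < length ys × AllPairs R ys × All (_∈ xs) ys) ⊎
  (∃[ ys ] w < length ys × ys ⊆ xs × AllPairs (λ x y → ¬ R x y × ¬ R y x) ys)
chain-or-antichain R? R-trans zero    w (x ∷ xs) _ =
  inj₁ (x ∷ [] , s≤s z≤n , [] ∷ [] , here refl ∷ [])
chain-or-antichain {R = R} R? R-trans (suc m) w xs lt = go
  where
  HasPred : _ → Set
  HasPred y = Any (λ x → R x y) xs

  pred? : Decidable HasPred
  pred? y = Any.any? (λ x → R? x y) xs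

  minimal = filter (λ y → ¬? (pred? y)) xs
  others  = filter pred? xs

  antichain : AllPairs (λ x y → ¬ R x y × ¬ R y x) minimal
  -- `pairs` recurses over suffixes of `minimal`, but predecessors are sought in the whole of `xs`,
  -- so membership in `minimal` is carried along.
  antichain = pairs (All.all-filter (λ y → ¬? (pred? y)) xs) (All.tabulate λ z∈ → z∈)
    where
    pairs : ∀ {zs} → All (λ y → ¬ HasPred y) zs → All (_∈ minimal) zs →
            AllPairs (λ x y → ¬ R x y × ¬ R y x) zs
    pairs []       []       = []
    pairs (p ∷ ps) (i ∷ is) =
      All.zipWith (λ (q , j) → (λ r → q (witness i r)) , (λ r → p (witness j r))) (ps , is) ∷ pairs ps is
      where
      witness : ∀ {x y} → x ∈ minimal → R x y → HasPred y
      witness i r = Any.map (λ { refl → r }) (Any-resp-⊆ (filter-⊆ _ xs) i)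

  go : _
  go with w <? length minimal
  ... | yes w< = inj₂ (minimal , w< , filter-⊆ _ xs , antichain)
  ... | no  w≮ with chain-or-antichain R? R-trans m w others
                      (+-cancelˡ-< w _ _ (<-≤-trans lt (begin
                        length xs                       ≡⟨ sym (length-filter-¬ pred? xs) ⟩
                        length others + length minimal  ≡⟨ +-comm (length others) _ ⟩
                        length minimal + length others  ≤⟨ +-monoˡ-≤ (length others) (≮⇒≥ w≮) ⟩
                        w + length others               ∎)))
    where open ≤-Reasoning
  ... | inj₂ (ys , w< , ys⊆ , anti) = inj₂ (ys , w< , ⊆-trans ys⊆ (filter-⊆ _ xs) , anti)
  ... | inj₁ (y ∷ ys , m< , r ∷ rs , i ∷ is) with find (All.lookup (All.all-filter pred? xs) i)
  -- The chain is listed in the order of `R`, not in that of `xs`; hence it comes with memberships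
  -- rather than as a sublist.
  ... | x , x∈ , xy = inj₁ (x ∷ y ∷ ys , s≤s m< , (xy ∷ All.map (R-trans xy) r) ∷ r ∷ rs ,
                            x∈ ∷ All.map (Any-resp-⊆ (filter-⊆ _ xs)) (i ∷ is))

SameOrder : ℕ → ℕ → ℕ → ℕ → Set
SameOrder a b c d = (a < b × c < d) ⊎ (b < a × d < c)

SameOrder-sym : ∀ {a b c d} → SameOrder a b c d → SameOrder b a d c
SameOrder-sym (inj₁ p) = inj₂ p
SameOrder-sym (inj₂ p) = inj₁ p

Agree : ∀ {T : Set} → (T → ℕ) → (T → ℕ) → T → T → Set
Agree p q s t = SameOrder (p s) (p t) (q s) (q t)

-- The theorem of Beame, Blais and Huynh-Ngoc: as any two elements are ordered
-- alike by two of the three orders, an antichain for both (p₁ , p₂) and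
-- (p₁ , p₃) is ordered alike by p₂ and p₃.
two-of-three-agree : ∀ {T : Set} (p₁ p₂ p₃ : T → ℕ) {ts : List T} m →
  AllPairs (λ s t → p₁ s ≢ p₁ t × p₂ s ≢ p₂ t × p₃ s ≢ p₃ t) ts → m * (m * m) < length ts →
  ∃[ ys ] m < length ys × All (_∈ ts) ys ×
    (AllPairs (Agree p₁ p₂) ys ⊎ AllPairs (Agree p₁ p₃) ys ⊎ AllPairs (Agree p₂ p₃) ys)
two-of-three-agree p₁ p₂ p₃ {ts} m distinct lt = go
  where
  Below : (_ → ℕ) → (_ → ℕ) → _ → _ → Set
  Below p q s t = p s < p t × q s < q t

  below? : ∀ p q s t → Dec (Below p q s t)
  below? p q s t = (p s <? p t) ×-dec (q s <? q t)

  below-trans : ∀ p q {r s t} → Below p q r s → Below p q s t → Below p q r t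
  below-trans p q (a , b) (c , d) = <-trans a c , <-trans b d

  reversed : ∀ {a b c d} → a < b → c ≢ d → ¬ (a < b × c < d) → d < c
  reversed a<b c≢d ¬p = ≤∧≢⇒< (≮⇒≥ λ c<d → ¬p (a<b , c<d)) (λ d≡c → c≢d (sym d≡c))

  resolve : ∀ {s t} → p₁ s ≢ p₁ t × p₂ s ≢ p₂ t × p₃ s ≢ p₃ t →
            (¬ Below p₁ p₂ s t × ¬ Below p₁ p₂ t s) × (¬ Below p₁ p₃ s t × ¬ Below p₁ p₃ t s) →
            Agree p₂ p₃ s t
  resolve {s} {t} (d₁ , d₂ , d₃) ((a , b) , (c , d)) with <-cmp (p₁ s) (p₁ t)
  -- On a pair incomparable in both senses, `p₂` and `p₃` each reverse `p₁`.
  ... | tri< l _ _ = inj₂ (reversed l d₂ a , reversed l d₃ c)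
  ... | tri≈ _ e _ = ⊥-elim (d₁ e)
  ... | tri> _ _ g = inj₁ (reversed g (λ e → d₂ (sym e)) b , reversed g (λ e → d₃ (sym e)) d)

  go : _
  -- Without a chain of more than `m` elements there is an antichain of more than `m * m`, large
  -- enough for a second application.
  go with chain-or-antichain (below? p₁ p₂) (below-trans p₁ p₂) m (m * m) ts lt
  ... | inj₁ (ys , m< , chain , ys∈) = ys , m< , ys∈ , inj₁ (AllPairs.map inj₁ chain)
  ... | inj₂ (ys , lt′ , ys⊆ , anti)
    with chain-or-antichain (below? p₁ p₃) (below-trans p₁ p₃) m m ys lt′
  ... | inj₁ (zs , m< , chain , zs∈) =
        zs , m< , All.map (Any-resp-⊆ ys⊆) zs∈ , inj₂ (inj₁ (AllPairs.map inj₁ chain))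
  ... | inj₂ (zs , m< , zs⊆ , anti′) =
        zs , m< , All.tabulate (λ z∈ → Any-resp-⊆ ys⊆ (Any-resp-⊆ zs⊆ z∈)) ,
        inj₂ (inj₂ (AllPairs-zip resolve (AllPairs-resp-⊆ (⊆-trans zs⊆ ys⊆) distinct)
          (AllPairs-zip _,_ (AllPairs-resp-⊆ zs⊆ anti) anti′)))

-- Arithmetic of the block sizes and of the exponent 5/3.

cube-root : ∀ u → ∃[ m ] m * (m * m) ≤ u × u < suc m * (suc m * suc m)
cube-root zero    = 0 , z≤n , s≤s z≤n
cube-root (suc u) with cube-root u
... | m , lower , upper with suc u <? suc m * (suc m * suc m)
... | yes l = m , m≤n⇒m≤1+n lower , l
... | no ¬l = suc m , ≮⇒≥ ¬l , ≤-<-trans upper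
  (*-mono-< (n<1+n (suc m)) (*-mono-< (n<1+n (suc m)) (n<1+n (suc m))))

cube-mono : ∀ {a b} → a ≤ b → a * (a * a) ≤ b * (b * b)
cube-mono l = *-mono-≤ l (*-mono-≤ l l)

-- From r^3 u ≤ (r (m+1))^3 ≤ u^3 follows r^3 ≤ u^2, and r + 1 ≤ 2 r for positive r gives the factor
-- 8. Thus the number r + 1 of blocks is at most 2 u^(2/3).
block-count : ∀ u m r → 0 < u → u < suc m * (suc m * suc m) → r * suc m ≤ u →
              suc r * (suc r * suc r) ≤ 8 * (u * u)
block-count u m zero    0<u _     _  = ≤-trans (*-mono-≤ 0<u 0<u) (m≤n*m (u * u) 8)
block-count u m (suc r) 0<u upper le = begin
  suc (suc r) * (suc (suc r) * suc (suc r))  ≤⟨ cube-mono (≤-trans (s≤s (s≤s (m≤m+n r r))) (≤-reflexive (double r))) ⟩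
  (2 * suc r) * ((2 * suc r) * (2 * suc r))  ≡⟨ eight (suc r) ⟩
  8 * (suc r * (suc r * suc r))              ≤⟨ *-monoʳ-≤ 8 (*-cancelʳ-≤ _ (u * u) u cubes) ⟩
  8 * (u * u)                                ∎
  where
  open ≤-Reasoning
  instance u≢0 = >-nonZero 0<u
  double : ∀ r → 2 + (r + r) ≡ 2 * suc r
  double = solve-∀
  eight : ∀ s → (2 * s) * ((2 * s) * (2 * s)) ≡ 8 * (s * (s * s))
  eight = solve-∀
  product : ∀ s t → (s * (s * s)) * (t * (t * t)) ≡ (s * t) * ((s * t) * (s * t))
  product = solve-∀
  cubes : suc r * (suc r * suc r) * u ≤ u * u * u
  cubes = begin
    suc r * (suc r * suc r) * u                                 ≤⟨ *-monoʳ-≤ (suc r * (suc r * suc r)) (<⇒≤ upper) ⟩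
    suc r * (suc r * suc r) * (suc m * (suc m * suc m))         ≡⟨ product (suc r) (suc m) ⟩
    (suc r * suc m) * ((suc r * suc m) * (suc r * suc m))       ≤⟨ cube-mono le ⟩
    u * (u * u)                                                 ≡⟨ sym (*-assoc u u u) ⟩
    u * u * u                                                   ∎

-- The sweep uses r + 1 blocks and cells of size 5 (r + 1).
budget : ∀ u m r p → m * (m * m) ≤ u → r * suc m ≤ u → 0 < u → 20 * (u * suc r) ≤ p →
  suc r * (suc (3 * (m * (m * m))) + 2 * suc (p / (5 * suc r))) +
    r * (suc m * (5 * suc r)) + suc m * (r * suc r) ≤ p
-- After multiplication by 5, the term with the number of cells is at most 2p, since `X` is p
-- divided by 5R. The other terms add up to 15 + 15 + 30 = 3 · 20 times uR, at most 3p.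
budget u m r p m³≤u rm≤u 0<u large = *-cancelˡ-≤ 5 (begin
  5 * (R * (suc (3 * (m * (m * m))) + 2 * suc X) + r * (suc m * (5 * R)) + suc m * (r * R))
    ≡⟨ regroup R X r m (m * (m * m)) ⟩
  15 * R + 15 * (R * (m * (m * m))) + 30 * (r * suc m * R) + 2 * (X * (5 * R))
    ≤⟨ +-mono-≤ (+-mono-≤ (+-mono-≤
         (*-monoʳ-≤ 15 (m≤n*m R u)) (*-monoʳ-≤ 15 (*-monoʳ-≤ R m³≤u))) (*-monoʳ-≤ 30 (*-monoˡ-≤ R rm≤u)))
         (*-monoʳ-≤ 2 (m/n*n≤m p (5 * R))) ⟩
  15 * (u * R) + 15 * (R * u) + 30 * (u * R) + 2 * p
    ≡⟨ total u R p ⟩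
  3 * (20 * (u * R)) + 2 * p
    ≤⟨ +-monoˡ-≤ (2 * p) (*-monoʳ-≤ 3 large) ⟩
  3 * p + 2 * p
    ≡⟨ sym (*-distribʳ-+ p 3 2) ⟩
  5 * p ∎)
  where
  open ≤-Reasoning
  R = suc r
  X = p / (5 * R)
  instance u≢0 = >-nonZero 0<u
  regroup : ∀ R X r m a → 5 * (R * (suc (3 * a) + 2 * suc X) + r * (suc m * (5 * R)) + suc m * (r * R)) ≡
            15 * R + 15 * (R * a) + 30 * (r * suc m * R) + 2 * (X * (5 * R))
  regroup = solve-∀
  total : ∀ u R p → 15 * (u * R) + 15 * (R * u) + 30 * (u * R) + 2 * p ≡ 3 * (20 * (u * R)) + 2 * p
  total = solve-∀

-- A record rather than a synonym: unification would unfold the numerals.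
record Large (u n : ℕ) : Set where
  constructor large
  field exceeds : 4 ^ 3 * (8 * u) ^ 5 < n ^ 3

-- Cubing clears the exponent 2/3: (c u R)^3 ≤ 8 c^3 u^5. What remains is the inequality `constants`
-- between numbers.
block-bound : ∀ a b c u R → c * (c * c) * 8 ≤ a * b ^ 5 → R * (R * R) ≤ 8 * (u * u) →
              (c * (u * R)) ^ 3 ≤ a * (b * u) ^ 5
block-bound a b c u R constants blocks = begin
  (c * (u * R)) ^ 3                            ≡⟨ expand c u R ⟩
  c * (c * c) * (u * (u * u) * (R * (R * R)))  ≤⟨ *-monoʳ-≤ (c * (c * c)) (*-monoʳ-≤ (u * (u * u)) blocks) ⟩
  c * (c * c) * (u * (u * u) * (8 * (u * u)))  ≡⟨ collect (c * (c * c)) 8 u ⟩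
  c * (c * c) * 8 * u ^ 5                      ≤⟨ *-monoˡ-≤ (u ^ 5) constants ⟩
  a * b ^ 5 * u ^ 5                            ≡⟨ merge a b u ⟩
  a * (b * u) ^ 5                              ∎
  where
  open ≤-Reasoning
  expand : ∀ c u R → c * (u * R) * (c * (u * R) * (c * (u * R) * 1)) ≡
           c * (c * c) * (u * (u * u) * (R * (R * R)))
  expand = solve-∀
  collect : ∀ c d u → c * (u * (u * u) * (d * (u * u))) ≡ c * d * (u * (u * (u * (u * (u * 1)))))
  collect = solve-∀
  merge : ∀ a b u → a * (b * (b * (b * (b * (b * 1))))) * (u * (u * (u * (u * (u * 1))))) ≡
          a * (b * u * (b * u * (b * u * (b * u * (b * u * 1)))))
  merge = solve-∀

-- A third of more than 4 (8u)^(5/3) = 128 u^(5/3) exceeds 40 u^(5/3), and R ≤ 2 u^(2/3). The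
-- numerical inequality is 60^3 · 8 ≤ 4^3 · 8^5.
Large-third : ∀ {u n p R} → Large u n → n ≤ 3 * p → R * (R * R) ≤ 8 * (u * u) → 20 * (u * R) ≤ p
Large-third {u} {n} {p} {R} (large exceeds) n≤3p blocks = ≮⇒≥ λ p< → <⇒≱ exceeds (begin
  n ^ 3                    ≤⟨ ^-monoˡ-≤ 3 n≤3p ⟩
  (3 * p) ^ 3              ≤⟨ ^-monoˡ-≤ 3 (*-monoʳ-≤ 3 (<⇒≤ p<)) ⟩
  (3 * (20 * (u * R))) ^ 3 ≡⟨ cong (_^ 3) (sym (*-assoc 3 20 (u * R))) ⟩
  (60 * (u * R)) ^ 3       ≤⟨ block-bound (4 ^ 3) 8 60 u R (≤ᵇ⇒≤ _ _ tt) blocks ⟩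
  4 ^ 3 * (8 * u) ^ 5      ∎)
  where open ≤-Reasoning

-- Halving `u` divides u^(5/3) by more than 3, because 3^3 = 27 ≤ 32 = 2^5; so a third of the edges
-- suffices for half of the twins.
Large-half : ∀ {u v n l} → v + v ≤ u → Large u n → n ≤ 3 * l → Large v l
Large-half {u} {v} {n} {l} v+v≤u (large exceeds) n≤3l = large (≰⇒> λ l³≤ → <⇒≱ exceeds (begin
  n ^ 3                       ≤⟨ ^-monoˡ-≤ 3 n≤3l ⟩
  (3 * l) ^ 3                 ≡⟨ cubed 3 l ⟩
  27 * l ^ 3                  ≤⟨ *-monoʳ-≤ 27 l³≤ ⟩
  27 * (4 ^ 3 * (8 * v) ^ 5)  ≤⟨ *-monoˡ-≤ (4 ^ 3 * (8 * v) ^ 5) (≤ᵇ⇒≤ 27 32 tt) ⟩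
  32 * (4 ^ 3 * (8 * v) ^ 5)  ≡⟨ doubled (4 ^ 3) 2 (8 * v) ⟩
  4 ^ 3 * (2 * (8 * v)) ^ 5   ≤⟨ *-monoʳ-≤ (4 ^ 3) (^-monoˡ-≤ 5 2[8v]≤8u) ⟩
  4 ^ 3 * (8 * u) ^ 5         ∎))
  where
  open ≤-Reasoning
  cubed : ∀ a l → a * l * (a * l * (a * l * 1)) ≡ a * (a * (a * 1)) * (l * (l * (l * 1)))
  cubed = solve-∀
  doubled : ∀ c d w → d * (d * (d * (d * (d * 1)))) * (c * (w * (w * (w * (w * (w * 1)))))) ≡
            c * (d * w * (d * w * (d * w * (d * w * (d * w * 1)))))
  doubled = solve-∀
  swapped : ∀ v → 2 * (8 * v) ≡ 8 * (v + v)
  swapped = solve-∀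
  2[8v]≤8u : 2 * (8 * v) ≤ 8 * u
  2[8v]≤8u = ≤-trans (≤-reflexive (swapped v)) (*-monoʳ-≤ 8 v+v≤u)

Large⇒0< : ∀ {u n} → Large u n → 0 < n
Large⇒0< {n = suc n} _ = s≤s z≤n

-- A crude bound, but it leaves at least two elements in a third of the list, as the recursion on
-- `u` demands.
Large⇒4≤ : ∀ {u n} → 0 < u → Large u n → 4 ≤ n
Large⇒4≤ {u} {n} 0<u (large exceeds) = ≰⇒> λ n≤3 → <⇒≱ exceeds (≤-trans (^-monoˡ-≤ 3 n≤3)
  (*-mono-≤ (≤ᵇ⇒≤ 27 64 tt) (^-monoˡ-≤ 5 {1} {8 * u} (*-mono-≤ (≤ᵇ⇒≤ 1 8 tt) 0<u))))

-- Twins in a permutation given by positions and values.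

AllPairs-take-drop : ∀ {A : Set} {R : A → A → Set} n {xs} → AllPairs R xs →
                     All (λ x → All (R x) (drop n xs)) (take n xs)
AllPairs-take-drop zero    _        = []
AllPairs-take-drop (suc n) []       = []
AllPairs-take-drop (suc n) (r ∷ rs) = All.drop⁺ n r ∷ AllPairs-take-drop n rs

module Permutation {A : Set} (pos val : A → ℕ)
  (pos-injective : ∀ {x y} → pos x ≡ pos y → x ≡ y)
  (val-injective : ∀ {x y} → val x ≡ val y → x ≡ y) where

  val-< : ∀ {x y} → val x ≤ val y → x ≢ y → val x < val y
  val-< x≤y x≢y = ≤∧≢⇒< x≤y λ e → x≢y (val-injective e)

  val-connex : ∀ {x y} → x ≢ y → val x < val y ⊎ val y < val x
  val-connex {x} {y} x≢y with <-cmp (val x) (val y)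
  ... | tri< l _ _ = inj₁ l
  ... | tri≈ _ e _ = ⊥-elim (x≢y (val-injective e))
  ... | tri> _ _ g = inj₂ g

  -- Meant for pairs with `val x < val y`. Disjointness of the value intervals then makes first and
  -- second points compare alike by value, and keeps the pairs from sharing a point.
  Separated : A × A → A × A → Set
  Separated (x , y) (x′ , y′) = val y < val x′ ⊎ val y′ < val x

  Compatible : A × A → A × A → Set
  Compatible (x , y) (x′ , y′) =
    SameOrder (pos x) (pos x′) (pos y) (pos y′) × Separated (x , y) (x′ , y′)

  module Cells (κ : A → ℕ) (κ-mono : ∀ {x y} → val x < val y → κ x ≤ κ y) where

    -- As `κ` is monotone in the value, `κ z ≤ κ x` puts all three points into one cell.
    InCell : List A → A × A × A → Set
    InCell xs (x , y , z) =
      (val x < val y × val y < val z) × κ z ≤ κ x × (x ∈ xs × y ∈ xs × z ∈ xs)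

    Before : A × A × A → A × A × A → Set
    Before (_ , _ , z) (x′ , _ , _) = val z < val x′

    weaken : ∀ {xs ys} → (∀ {x} → x ∈ xs → x ∈ ys) → ∀ {t} → InCell xs t → InCell ys t
    weaken f (l , e , x∈ , y∈ , z∈) = l , e , f x∈ , f y∈ , f z∈

    2+m+2n : ∀ m n → 2 + m + 2 * n ≡ m + 2 * suc n
    2+m+2n = solve-∀

    -- At most two points of each of the c - j cells are left over.
    triples : ∀ N c j zs → length zs ≤ N → AllPairs (λ x y → val x < val y) zs →
      All (λ z → j ≤ κ z) zs → All (λ z → κ z < c) zs → j ≤ c →
      ∃[ ts ] length zs + 2 * j ≤ 3 * length ts + 2 * c × AllPairs Before ts × All (InCell zs) ts
    triples N c j []       _ _ _ _ j≤c = [] , *-monoʳ-≤ 2 j≤c , [] , []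
    triples N c j (x ∷ []) _ _ (j≤ ∷ _) (<c ∷ _) _ =
      [] , ≤-trans (n≤1+n _) (≤-trans (≤-reflexive (sym (*-suc 2 j))) (*-monoʳ-≤ 2 (≤-<-trans j≤ <c))) , [] , []
    triples N c j (x ∷ y ∷ []) _ _ (j≤ ∷ _) (<c ∷ _) _ =
      [] , ≤-trans (≤-reflexive (sym (*-suc 2 j))) (*-monoʳ-≤ 2 (≤-<-trans j≤ <c)) , [] , []
    triples (suc N) c j (x ∷ y ∷ z ∷ zs) (s≤s ≤N) ((xy ∷ xz ∷ _) ∷ (yz ∷ yzs) ∷ zzs ∷ s)
        (jx ∷ jy ∷ jz ∷ js) (cx ∷ cy ∷ cz ∷ cs) j≤c
      -- If `y` or `z` lies beyond the cell of `x`, the points before it are dropped, at most two,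
      -- and paid for by raising `j`. Otherwise the three form a triple. `N` bounds the length and
      -- makes the recursion structural.
      with κ x <? κ y | κ x <? κ z
    ... | yes x<y | _ with triples N c (suc j) (y ∷ z ∷ zs) ≤N ((yz ∷ yzs) ∷ zzs ∷ s)
                             (All.map (λ le → ≤-<-trans jx (<-≤-trans x<y le))
                               (≤-refl ∷ κ-mono yz ∷ All.map κ-mono yzs))
                             (cy ∷ cz ∷ cs) (≤-<-trans jx cx)
    ... | ts , le , before , inCell =
          ts , ≤-trans shift le , before , All.map (weaken there) inCell
          where
          shift : suc (length (y ∷ z ∷ zs)) + 2 * j ≤ length (y ∷ z ∷ zs) + 2 * suc j
          shift = ≤-trans (n≤1+n _) (≤-reflexive (2+m+2n (length (y ∷ z ∷ zs)) j))
    triples (suc N) c j (x ∷ y ∷ z ∷ zs) (s≤s ≤N) ((xy ∷ xz ∷ _) ∷ (yz ∷ yzs) ∷ zzs ∷ s)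
        (jx ∷ jy ∷ jz ∷ js) (cx ∷ cy ∷ cz ∷ cs) j≤c
        | no _ | yes x<z with triples N c (suc j) (z ∷ zs) (m+n≤o⇒n≤o 1 ≤N) (zzs ∷ s)
                             (All.map (λ le → ≤-<-trans jx (<-≤-trans x<z le)) (≤-refl ∷ All.map κ-mono zzs))
                             (cz ∷ cs) (≤-<-trans jx cx)
    ... | ts , le , before , inCell =
          ts , ≤-trans (≤-reflexive (2+m+2n (length (z ∷ zs)) j)) le , before ,
          All.map (weaken λ i → there (there i)) inCell
    triples (suc N) c j (x ∷ y ∷ z ∷ zs) (s≤s ≤N) ((xy ∷ xz ∷ _) ∷ (yz ∷ yzs) ∷ zzs ∷ s)
        (jx ∷ jy ∷ jz ∷ js) (cx ∷ cy ∷ cz ∷ cs) j≤c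
        | no _ | no x≮z with triples N c j zs (m+n≤o⇒n≤o 2 ≤N) s js cs j≤c
    ... | ts , le , before , inCell =
          (x , y , z) ∷ ts ,
          ≤-trans (+-monoʳ-≤ 3 le) (≤-reflexive (cong (_+ 2 * c) (sym (*-suc 3 (length ts))))) ,
          All.map (λ (_ , _ , x∈ , _) → All.lookup zzs x∈) inCell ∷ before ,
          ((xy , yz) , ≮⇒≥ x≮z , here refl , there (here refl) , there (there (here refl))) ∷
          All.map (weaken λ i → there (there (there i))) inCell

    Chosen : List A → A × A → Set
    Chosen xs (x , y) = val x < val y × κ x ≡ κ y × x ∈ xs × y ∈ xs

    -- `f` and `g` pick two points of a triple. The bounds keep their value interval inside that of
    -- the triple, so that disjoint triples yield separated pairs.
    Selects : (A × A × A → A) → (A × A × A → A) → Set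
    Selects f g = ∀ {xs t} → InCell xs t →
      val (proj₁ t) ≤ val (f t) × val (g t) ≤ val (proj₂ (proj₂ t)) × Chosen xs (f t , g t)

    -- Truncation to exactly m + 1 pairs lets the sweep know in advance how many cells each block
    -- will face.
    select : ∀ {f g} → Selects f g → ∀ {xs ts ys} m → AllPairs Before ts → All (InCell xs) ts →
      m < length ys → All (_∈ ts) ys → AllPairs (Agree (λ t → pos (f t)) (λ t → pos (g t))) ys →
      ∃[ U ] length U ≡ suc m × AllPairs Compatible U × All (Chosen xs) U
    select {f} {g} sel {xs} {ts} {ys} m before inCell m< ys∈ agree =
      map (λ t → f t , g t) (take (suc m) ys) ,
      trans (length-map _ (take (suc m) ys)) (trans (length-take (suc m) ys) (m≤n⇒m⊓n≡m m<)) ,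
      AllPairs.map⁺ (AllPairs.take⁺ (suc m) (AllPairs-members compatible ys∈ agree)) ,
      All.map⁺ (All.take⁺ (suc m) (All.map (λ t∈ → proj₂ (proj₂ (sel (All.lookup inCell t∈)))) ys∈))
      where
      irreflexive : ∀ {a b} → ¬ SameOrder a a b b
      irreflexive (inj₁ (l , _)) = <-irrefl refl l
      irreflexive (inj₂ (l , _)) = <-irrefl refl l

      separated : ∀ {t t′} → t ∈ ts → t′ ∈ ts → Before t t′ → val (g t) < val (f t′)
      separated t∈ t′∈ b with sel (All.lookup inCell t∈) | sel (All.lookup inCell t′∈)
      ... | _ , le , _ | le′ , _ = ≤-<-trans le (<-≤-trans b le′)

      compatible : ∀ {t t′} → t ∈ ts → t′ ∈ ts → Agree (λ t → pos (f t)) (λ t → pos (g t)) t t′ →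
                   Compatible (f t , g t) (f t′ , g t′)
      compatible t∈ t′∈ a
        with AllPairs-∈ swap (AllPairs.map {S = λ t t′ → Before t t′ ⊎ Before t′ t} inj₁ before)
               t∈ t′∈
      -- Agreement is strict, so no triple agrees with itself.
      ... | inj₁ refl     = ⊥-elim (irreflexive a)
      ... | inj₂ (inj₁ b) = a , inj₁ (separated t∈ t′∈ b)
      ... | inj₂ (inj₂ b) = a , inj₂ (separated t′∈ t∈ b)

    twins-in-block : ∀ m c xs → AllPairs _≢_ xs → All (λ x → κ x < c) xs →
      3 * (m * (m * m)) + 2 * c < length xs →
      ∃[ U ] length U ≡ suc m × AllPairs Compatible U × All (Chosen xs) U
    twins-in-block m c xs unique κ< lt
      with linearise {R = λ x y → val x < val y} <-trans (AllPairs.map val-connex unique)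
    ... | zs , zs↭ , sorted
      with triples (length zs) c 0 zs ≤-refl sorted (All.tabulate λ _ → z≤n) (All-resp-↭ (↭-sym zs↭) κ<) z≤n
    ... | ts , le , before , inCell = go
      where
      many : m * (m * m) < length ts
      many = *-cancelˡ-< 3 _ _ (+-cancelʳ-< (2 * c) _ _ (<-≤-trans lt (begin
        length xs                ≡⟨ sym (↭-length zs↭) ⟩
        length zs                ≤⟨ m≤m+n _ _ ⟩
        length zs + 2 * 0        ≤⟨ le ⟩
        3 * length ts + 2 * c    ∎)))
        where open ≤-Reasoning

      pos-≢ : ∀ {x y} → val x < val y → pos x ≢ pos y
      pos-≢ l e = <-irrefl (cong val (pos-injective e)) l

      inCell′ : All (InCell xs) ts
      inCell′ = All.map (weaken (∈-resp-↭ zs↭)) inCell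

      distinct = AllPairs-members
        (λ { ((xy , yz) , _) ((xy′ , yz′) , _) b →
          pos-≢ (<-trans xy (<-trans yz b)) ,
          pos-≢ (<-trans yz (<-trans b xy′)) ,
          pos-≢ (<-trans b (<-trans xy′ yz′)) }) inCell before

      go : _
      -- The three orders are by the positions of the lowest, middle and highest points; the two
      -- that agree name the points to keep from each triple.
      go with two-of-three-agree (λ (x , _ , _) → pos x) (λ (_ , y , _) → pos y) (λ (_ , _ , z) → pos z)
                m distinct many
      ... | ys , m< , ys∈ , inj₁ agree = select
        (λ { ((xy , yz) , e , x∈ , y∈ , z∈) → ≤-refl , <⇒≤ yz , xy , ≤-antisym (κ-mono xy) (≤-trans (κ-mono yz) e) , x∈ , y∈ })
        m before inCell′ m< ys∈ agree
      ... | ys , m< , ys∈ , inj₂ (inj₁ agree) = select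
        (λ { ((xy , yz) , e , x∈ , y∈ , z∈) → ≤-refl , ≤-refl , <-trans xy yz , ≤-antisym (κ-mono (<-trans xy yz)) e , x∈ , z∈ })
        m before inCell′ m< ys∈ agree
      ... | ys , m< , ys∈ , inj₂ (inj₂ agree) = select
        (λ { ((xy , yz) , e , x∈ , y∈ , z∈) → <⇒≤ xy , ≤-refl , yz , ≤-antisym (κ-mono yz) (≤-trans e (κ-mono xy)) , y∈ , z∈ })
        m before inCell′ m< ys∈ agree

  module Sweep (κ₀ : A → ℕ) (κ₀-mono : ∀ {x y} → val x < val y → κ₀ x ≤ κ₀ y)
               (q L : ℕ) (P : A → Set) where

    below : A → A → ℕ
    below y z with val y <? val z
    ... | yes _ = 1
    ... | no  _ = 0

    below-mono : ∀ y {z z′} → val z < val z′ → below y z ≤ below y z′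
    below-mono y {z} {z′} l with val y <? val z | val y <? val z′
    ... | yes _ | yes _ = ≤-refl
    ... | yes b | no ¬b = ⊥-elim (¬b (<-trans b l))
    ... | no  _ | _     = z≤n

    below≤1 : ∀ y z → below y z ≤ 1
    below≤1 y z with val y <? val z
    ... | yes _ = ≤-refl
    ... | no  _ = z≤n

    below-reflects : ∀ {y z z′} → below y z ≡ below y z′ → val y < val z′ → val y < val z
    below-reflects {y} {z} {z′} e b with val y <? val z | val y <? val z′
    ... | yes b′ | _     = b′
    ... | no _   | no ¬b = ⊥-elim (¬b b)

    -- Each used pair (x , y) splits its cell into the part below x and the part
    -- above y; the points in between are discarded.
    κ : List (A × A) → A → ℕ
    κ []            z = κ₀ z
    κ ((_ , y) ∷ U) z = below y z + κ U z

    κ-mono : ∀ U {z z′} → val z < val z′ → κ U z ≤ κ U z′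
    κ-mono []            l = κ₀-mono l
    κ-mono ((_ , y) ∷ U) l = +-mono-≤ (below-mono y l) (κ-mono U l)

    κ-bound : ∀ U {z} → κ₀ z < q → κ U z < length U + q
    κ-bound []            l = l
    κ-bound ((_ , y) ∷ U) l = +-mono-≤-< (below≤1 y _) (κ-bound U l)

    -- A sum of monotone terms that does not increase from `z` to `z′` has no increasing term.
    κ-split : ∀ U {z z′} → val z < val z′ → κ U z ≡ κ U z′ →
              κ₀ z ≡ κ₀ z′ × All (λ (_ , y) → below y z ≡ below y z′) U
    κ-split []            l e = e , []
    κ-split ((_ , y) ∷ U) {z} {z′} l e = proj₁ ih , below≡ ∷ proj₂ ih
      where
      below≡ : below y z ≡ below y z′
      below≡ = ≤-antisym (below-mono y l) (+-cancelʳ-≤ (κ U z) _ _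
        (≤-trans (+-monoʳ-≤ (below y z′) (κ-mono U l)) (≤-reflexive (sym e))))
      ih = κ-split U l (+-cancelˡ-≡ (below y z) _ _ (trans e (cong (_+ κ U z′) (sym below≡))))

    Outside : A → A × A → Set
    Outside z (x , y) = val z < val x ⊎ val y < val z

    -- Points on opposite sides of the interval would differ in whether they exceed `y`.
    separated : ∀ {z z′ x y} → val z < val z′ → Outside z (x , y) → Outside z′ (x , y) →
                below y z ≡ below y z′ → Separated (z , z′) (x , y)
    separated _ (inj₂ l) _        _ = inj₂ l
    separated _ _        (inj₁ l) _ = inj₁ l
    separated _ _        (inj₂ l) e = inj₂ (below-reflects e l)

    -- Half open, so that the points in between are counted by a difference of ranks. The excluded
    -- `y` is no later point, since its position precedes them all.
    Between : A × A → A → Set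
    Between (x , y) z = val x ≤ val z × val z < val y

    between? : ∀ p → Decidable (Between p)
    between? (x , y) z = (val x ≤? val z) ×-dec (val z <? val y)

    Light : List A → Set
    Light xs = ∀ {x y} → κ₀ x ≡ κ₀ y → length (filter (between? (x , y)) xs) ≤ L

    Light-⊆ : ∀ {xs ys} → xs ⊆ ys → Light ys → Light xs
    Light-⊆ τ light e = ≤-trans (length-filter-mono-⊆ (between? _) τ) (light e)

    -- Each pair shares an initial cell and lightness passes to sublists, so a pair costs at most
    -- `L` points.
    prune : ∀ U {xs} → All (λ (x , y) → κ₀ x ≡ κ₀ y) U → Light xs →
            ∃[ ys ] ys ⊆ xs × length xs ≤ length ys + length U * L ×
              All (λ z → All (λ p → ¬ Between p z) U) ys
    prune []      {xs} _        light = xs , ⊆-refl , ≤-reflexive (sym (+-identityʳ _)) , All.tabulate λ _ → []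
    prune (p ∷ U) {xs} (e ∷ es) light with prune U es light
    ... | ys , τ , le , out =
      kept , ⊆-trans (filter-⊆ _ ys) τ ,
      (begin
        length xs                                              ≤⟨ le ⟩
        length ys + length U * L                               ≡⟨ cong (_+ length U * L) (sym (length-filter-¬ (between? p) ys)) ⟩
        length (filter (between? p) ys) + length kept + length U * L  ≤⟨ +-monoˡ-≤ (length U * L) (+-monoˡ-≤ (length kept) (Light-⊆ τ light e)) ⟩
        L + length kept + length U * L                         ≡⟨ cong (_+ length U * L) (+-comm L _) ⟩
        length kept + L + length U * L                         ≡⟨ +-assoc (length kept) L _ ⟩
        length kept + (L + length U * L)                       ∎) ,
      All.zipWith (λ (n , o) → n ∷ o) (All.all-filter (λ z → ¬? (between? p z)) ys , All-resp-⊆ (filter-⊆ _ ys) out)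
      where
      open ≤-Reasoning
      kept = filter (λ z → ¬? (between? p z)) ys

    Valid : A × A → Set
    Valid (x , y) = val x < val y × P x × P y

    Earlier : A → A × A → Set
    Earlier z (x , y) = pos x < pos z × pos y < pos z

    -- The points that suffice for r + 1 more blocks when `s` pairs are in use: the blocks at the
    -- present number s + q of cells, r prunings by m + 1 pairs, and two points per cell added
    -- later, which sum to (m+1) r (r+1).
    need : ℕ → ℕ → ℕ → ℕ
    need m s r = suc r * (suc (3 * (m * (m * m))) + 2 * (s + q)) + r * (suc m * L) + suc m * (r * suc r)

    need-suc : ∀ m s r → need m s (suc r) ≡
               (suc (3 * (m * (m * m))) + 2 * (s + q)) + (suc m * L + need m (suc m + s) r)
    need-suc = lemma q L
      where
      lemma : ∀ q L m s r →
        suc (suc r) * (suc (3 * (m * (m * m))) + 2 * (s + q)) + suc r * (suc m * L) + suc m * (suc r * suc (suc r)) ≡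
        (suc (3 * (m * (m * m))) + 2 * (s + q)) +
        (suc m * L + (suc r * (suc (3 * (m * (m * m))) + 2 * ((suc m + s) + q)) + r * (suc m * L) + suc m * (r * suc r)))
      lemma = solve-∀

    -- The points are read from left to right in r + 1 blocks, each of which
    -- contributes m + 1 pairs.
    sweep : ∀ r m U xs → AllPairs (λ x y → pos x < pos y) xs → Light xs → All (λ z → κ₀ z < q) xs → All P xs →
      AllPairs Compatible U → All Valid U → All (λ z → All (Earlier z) U) xs → All (λ z → All (Outside z) U) xs →
      need m (length U) r ≤ length xs →
      ∃[ V ] length V ≡ suc r * suc m + length U × AllPairs Compatible V × All Valid V
    sweep r m U xs sorted light κ< members compatible valid earlier outside enough
      with Cells.twins-in-block (κ U) (κ-mono U) m (length U + q) (take B xs)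
             (AllPairs.take⁺ B (AllPairs.map (λ l e → <-irrefl (cong pos e) l) sorted))
             (All.take⁺ B (All.map (κ-bound U) κ<))
             -- A block is as small as `twins-in-block` permits, one point more than 3 m^3 + 2 c for
             -- c = `length U + q`.
             (≤-reflexive (sym (trans (length-take B xs) (m≤n⇒m⊓n≡m (B≤ r enough)))))
      where
      B = suc (3 * (m * (m * m))) + 2 * (length U + q)
      B≤ : ∀ r → need m (length U) r ≤ length xs → B ≤ length xs
      B≤ r enough = ≤-trans (≤-trans (m≤m+n B _) (≤-trans (m≤m+n _ _) (m≤m+n _ _))) enough
    ... | N , len , compatibleN , chosen = go r enough
      where
      B = suc (3 * (m * (m * m))) + 2 * (length U + q)
      block rest : List A
      block = take B xs
      rest  = drop B xs

      fromBlock : ∀ {Q : A → Set} → All Q xs → ∀ {x} → x ∈ block → Q x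
      fromBlock qs x∈ = All.lookup (All.take⁺ B qs) x∈

      cross : ∀ {x y} → Cells.Chosen (κ U) (κ-mono U) block (x , y) → All (Compatible (x , y)) U
      -- Older pairs precede both points in position; separation holds because the two points lie
      -- outside the old intervals and share a cell of `κ U`.
      cross {x} {y} (l , e , x∈ , y∈) = All.zipWith
        (λ { ((e₁ , e₂) , (o₁ , o₂) , b) → inj₂ (proj₁ e₁ , proj₂ e₂) , separated l o₁ o₂ b })
        (All.zip (fromBlock earlier x∈ , fromBlock earlier y∈) ,
         All.zip (All.zip (fromBlock outside x∈ , fromBlock outside y∈) , proj₂ (κ-split U l e)))

      U′ : List (A × A)
      U′ = N ++ U

      compatible′ : AllPairs Compatible U′
      compatible′ = AllPairs.++⁺ compatibleN compatible (All.map cross chosen)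

      valid′ : All Valid U′
      valid′ = All.++⁺ (All.map (λ (l , _ , x∈ , y∈) → l , fromBlock members x∈ , fromBlock members y∈) chosen) valid

      length′ : length U′ ≡ suc m + length U
      length′ = trans (length-++ N) (cong (_+ length U) len)

      go : ∀ r → need m (length U) r ≤ length xs →
           ∃[ V ] length V ≡ suc r * suc m + length U × AllPairs Compatible V × All Valid V
      go zero    _ = U′ , trans length′ (cong (_+ length U) (sym (+-identityʳ (suc m)))) , compatible′ , valid′
      -- Only the new pairs `N` are pruned for; the points are already outside the intervals of `U`.
      go (suc r) enough with prune N (All.map (λ (l , e , _) → proj₁ (κ-split U l e)) chosen)
                               (Light-⊆ (drop-⊆ B xs) light)
      ... | ys , τ , le , notBetween
        with sweep r m U′ ys (AllPairs-resp-⊆ τ (AllPairs.drop⁺ B sorted)) (Light-⊆ ys⊆ light)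
               (All-resp-⊆ ys⊆ κ<) (All-resp-⊆ ys⊆ members) compatible′ valid′
               (All.zipWith (λ (a , b) → All.++⁺ a b) (earlierN , All-resp-⊆ ys⊆ earlier))
               (All.zipWith (λ (a , b) → All.++⁺ a b) (outsideN , All-resp-⊆ ys⊆ outside))
               enough′
        where
        ys⊆ : ys ⊆ xs
        ys⊆ = ⊆-trans τ (drop-⊆ B xs)

        earlierN : All (λ z → All (Earlier z) N) ys
        earlierN = All.tabulate λ z∈ → All.map
          (λ (_ , _ , x∈ , y∈) → after x∈ z∈ , after y∈ z∈) chosen
          where
          after : ∀ {x z} → x ∈ block → z ∈ ys → pos x < pos z
          after x∈ z∈ = All.lookup (All.lookup (AllPairs-take-drop B sorted) x∈) (Any-resp-⊆ τ z∈)

        outsideN : All (λ z → All (Outside z) N) ys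
        outsideN = All.zipWith (All.zipWith λ (n , e) → outsidePair n e) (notBetween , earlierN)
          where
          outsidePair : ∀ {p z} → ¬ Between p z → Earlier z p → Outside z p
          outsidePair {x , y} {z} n (_ , y<z) with val x ≤? val z
          ... | no  x≰z = inj₁ (≰⇒> x≰z)
          ... | yes x≤z = inj₂ (val-< (≮⇒≥ λ z<y → n (x≤z , z<y)) (λ e → <-irrefl (cong pos e) y<z))

        enough′ : need m (length U′) r ≤ length ys
        enough′ = subst (λ s → need m s r ≤ length ys) (sym length′)
          (+-cancelˡ-≤ (suc m * L) _ _ (+-cancelˡ-≤ B _ _ (begin
            B + (suc m * L + need m (suc m + length U) r)  ≡⟨ sym (need-suc m (length U) r) ⟩
            need m (length U) (suc r)                      ≤⟨ enough ⟩
            length xs                                      ≤⟨ m≤n+m∸n (length xs) B ⟩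
            B + (length xs ∸ B)                            ≡⟨ cong (B +_) (sym (length-drop B xs)) ⟩
            B + length rest                                ≤⟨ +-monoʳ-≤ B le ⟩
            B + (length ys + length N * L)                 ≡⟨ cong (λ k → B + (length ys + k * L)) len ⟩
            B + (length ys + suc m * L)                    ≡⟨ cong (B +_) (+-comm (length ys) _) ⟩
            B + (suc m * L + length ys)                    ∎)))
          where open ≤-Reasoning
      ... | V , lenV , compatibleV , validV =
        V , trans lenV (trans (cong (suc r * suc m +_) length′) (shuffle (suc r * suc m) (suc m) (length U))) ,
        compatibleV , validV
        where
        shuffle : ∀ a b c → a + (b + c) ≡ b + a + c
        shuffle = solve-∀

  rank : List A → A → ℕ
  rank xs z = length (filter (λ w → val w <? val z) xs)

  between+rank : ∀ xs {x y} → val x < val y →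
    length (filter (λ w → (val x ≤? val w) ×-dec (val w <? val y)) xs) + rank xs x ≤ rank xs y
  between+rank xs {x} {y} l = length-filter-⊎ _ _ _
    (λ (x≤w , _) w<x → <⇒≱ w<x x≤w) proj₂ (λ w<x → <-trans w<x l) xs

  module _ (xs : List A) (L : ℕ) .{{_ : NonZero L}} where

    -- The initial cells consist of at most `L` consecutive ranks.
    rankCell : A → ℕ
    rankCell z = rank xs z / L

    rankCell-mono : ∀ {x y} → val x < val y → rankCell x ≤ rankCell y
    rankCell-mono l = /-monoˡ-≤ L (≤-trans (m≤n+m _ _) (between+rank xs l))

    -- Equal quotients leave a difference of ranks of at most `L`. If `x` is not below `y` in value,
    -- nothing lies between.
    rankCell-light : ∀ {x y} → rankCell x ≡ rankCell y →
      length (filter (λ w → (val x ≤? val w) ×-dec (val w <? val y)) xs) ≤ L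
    rankCell-light {x} {y} e = go (val x <? val y)
      where
      between? : Decidable (λ w → val x ≤ val w × val w < val y)
      between? w = (val x ≤? val w) ×-dec (val w <? val y)

      go : Dec (val x < val y) → length (filter between? xs) ≤ L
      go (no x≮y)  = subst (λ zs → length zs ≤ L)
        (sym (filter-none between? (All.tabulate {xs = xs} λ _ (x≤w , w<y) → x≮y (≤-<-trans x≤w w<y)))) z≤n
      go (yes x<y) = +-cancelʳ-≤ (rank xs x) _ _ (begin
        length (filter between? xs) + rank xs x    ≤⟨ between+rank xs x<y ⟩
        rank xs y                                  ≡⟨ m≡m%n+[m/n]*n (rank xs y) L ⟩
        rank xs y % L + rankCell y * L             ≤⟨ +-mono-≤ (<⇒≤ (m%n<n (rank xs y) L)) (≤-reflexive (cong (_* L) (sym e))) ⟩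
        L + rankCell x * L                         ≤⟨ +-monoʳ-≤ L (m/n*n≤m (rank xs x) L) ⟩
        L + rank xs x                              ∎)
        where open ≤-Reasoning

  pos-connex : ∀ {x y} → x ≢ y → pos x < pos y ⊎ pos y < pos x
  pos-connex {x} {y} x≢y with <-cmp (pos x) (pos y)
  ... | tri< l _ _ = inj₁ l
  ... | tri≈ _ e _ = ⊥-elim (x≢y (pos-injective e))
  ... | tri> _ _ g = inj₂ g

  -- With R = 2 u^(2/3), the hypothesis asks for 40 u^(5/3) points.
  permutation-twins : ∀ u xs → AllPairs _≢_ xs → 0 < u →
    (∀ R → R * (R * R) ≤ 8 * (u * u) → 20 * (u * R) ≤ length xs) →
    ∃[ V ] u < length V × AllPairs Compatible V × All (λ (x , y) → val x < val y × x ∈ xs × y ∈ xs) V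
  permutation-twins u xs unique 0<u enough
    with linearise {R = λ x y → pos x < pos y} <-trans (AllPairs.map pos-connex unique) | cube-root u
  ... | ys , ys↭ , sorted | m , lower , upper = enlarge swept
    where
    -- Then r + 1 blocks of m + 1 pairs give more than `u` pairs.
    r = u / suc m
    -- A balance: larger cells lose more points to pruning, smaller ones leave more points outside
    -- triples. Here the original cells leave over about two fifths of all points, in all blocks
    -- together.
    L = 5 * suc r
    q = suc (length ys / L)
    open Sweep (rankCell ys L) (rankCell-mono ys L) q L (_∈ xs)

    r[m+1]≤u : r * suc m ≤ u
    r[m+1]≤u = m/n*n≤m u (suc m)

    enough′ : need m 0 r ≤ length ys
    enough′ = budget u m r (length ys) lower r[m+1]≤u 0<u
      (subst (20 * (u * suc r) ≤_) (sym (↭-length ys↭)) (enough (suc r) (block-count u m r 0<u upper r[m+1]≤u)))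

    swept : ∃[ V ] length V ≡ suc r * suc m + 0 × AllPairs Compatible V × All Valid V
    swept = sweep r m [] ys sorted (rankCell-light ys L)
      (All.tabulate λ _ → s≤s (/-monoˡ-≤ L (length-filter _ ys)))
      (All.tabulate (∈-resp-↭ ys↭)) [] [] (All.tabulate λ _ → []) (All.tabulate λ _ → []) enough′

    u< : u < suc r * suc m + 0
    u< = begin-strict
      u                        ≡⟨ m≡m%n+[m/n]*n u (suc m) ⟩
      u % suc m + r * suc m    <⟨ +-monoˡ-< (r * suc m) (m%n<n u (suc m)) ⟩
      suc m + r * suc m        ≡⟨ sym (+-identityʳ _) ⟩
      suc r * suc m + 0        ∎
      where open ≤-Reasoning

    enlarge : ∃[ V ] length V ≡ suc r * suc m + 0 × AllPairs Compatible V × All Valid V →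
              ∃[ V ] u < length V × AllPairs Compatible V × All Valid V
    enlarge (V , lenV , compatible , valid) = V , subst (u <_) (sym lenV) u< , compatible , valid

-- Cutting the vertex line of a matching.

first-step : ∀ {P : ℕ → Set} → Decidable P → ¬ P 0 → ∀ N → P N → ∃[ m ] ¬ P m × P (suc m)
first-step P? ¬P0 zero    PN = ⊥-elim (¬P0 PN)
first-step P? ¬P0 (suc N) PN with P? N
... | no ¬PN = N , ¬PN , PN
... | yes p  = first-step P? ¬P0 N p

-- Together with `lo<hi`, the hypothesis `lo≡hi⇒≡` says that no left endpoint is a right endpoint.
module Matching {A : Set} (lo hi : A → ℕ) (lo<hi : ∀ x → lo x < hi x)
  (lo-injective : ∀ {x y} → lo x ≡ lo y → x ≡ y)
  (hi-injective : ∀ {x y} → hi x ≡ hi y → x ≡ y)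
  (lo≡hi⇒≡ : ∀ {x y} → lo x ≡ hi y → x ≡ y)
  (bound : ℕ) (hi<bound : ∀ x → hi x < bound) where

  Similar : A × A → A × A → Set
  Similar (e , f) (e′ , f′) =
    SameOrder (lo e) (lo e′) (lo f) (lo f′) × SameOrder (lo e) (hi e′) (lo f) (hi f′) ×
    SameOrder (hi e) (lo e′) (hi f) (lo f′) × SameOrder (hi e) (hi e′) (hi f) (hi f′)

  -- `e ≢ e′` and `f ≢ f′` follow from the strict comparisons; `e ≢ f` concerns a single pair and is
  -- recorded in `TwinsIn`.
  Twin : A × A → A × A → Set
  Twin (e , f) (e′ , f′) = Similar (e , f) (e′ , f′) × e ≢ f′ × f ≢ e′

  Twin-sym : ∀ {p q} → Twin p q → Twin q p
  Twin-sym ((ll , lh , hl , hh) , e≢f′ , f≢e′) =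
    (SameOrder-sym ll , SameOrder-sym hl , SameOrder-sym lh , SameOrder-sym hh) ,
    (λ e → f≢e′ (sym e)) , (λ e → e≢f′ (sym e))

  TwinsIn : List A → ℕ → Set
  TwinsIn xs u = ∃[ V ] u < length V × AllPairs Twin V × All (λ (e , f) → e ≢ f × e ∈ xs × f ∈ xs) V

  apart⇒Twin : ∀ {m e f e′ f′} → hi e < m → hi f < m → m ≤ lo e′ → m ≤ lo f′ → Twin (e , f) (e′ , f′)
  apart⇒Twin {m} {e} {f} {e′} {f′} e< f< ≤e′ ≤f′ =
    (inj₁ (<-trans (lo<hi e) e<e′ , <-trans (lo<hi f) f<f′) ,
     inj₁ (<-trans (lo<hi e) (<-trans e<e′ (lo<hi e′)) , <-trans (lo<hi f) (<-trans f<f′ (lo<hi f′))) ,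
     inj₁ (e<e′ , f<f′) ,
     inj₁ (<-trans e<e′ (lo<hi e′) , <-trans f<f′ (lo<hi f′))) ,
    (λ { refl → <-asym (lo<hi e) (<-≤-trans e< ≤f′) }) ,
    (λ { refl → <-asym (lo<hi f) (<-≤-trans f< ≤e′) })
    where
    e<e′ : hi e < lo e′
    e<e′ = <-≤-trans e< ≤e′
    f<f′ : hi f < lo f′
    f<f′ = <-≤-trans f< ≤f′

  -- Two strict bounds gain an extra one, which later makes up for rounding down when an odd number
  -- is halved.
  union : ∀ {m xs ys zs u v} → (∀ {x} → x ∈ xs → x ∈ zs × hi x < m) → (∀ {x} → x ∈ ys → x ∈ zs × m ≤ lo x) →
          TwinsIn xs u → TwinsIn ys v → TwinsIn zs (u + suc v)
  union {u = u} {v} left right (V , u< , twinsV , inV) (W , v< , twinsW , inW) =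
    V ++ W , subst (u + suc v <_) (sym (length-++ V)) (+-mono-<-≤ u< v<) ,
    AllPairs.++⁺ twinsV twinsW (All.map
      (λ (_ , e∈ , f∈) → All.map
        (λ (_ , e′∈ , f′∈) → apart⇒Twin (proj₂ (left e∈)) (proj₂ (left f∈)) (proj₂ (right e′∈)) (proj₂ (right f′∈)))
        inW) inV) ,
    All.++⁺ (All.map (λ (n , e∈ , f∈) → n , proj₁ (left e∈) , proj₁ (left f∈)) inV)
            (All.map (λ (n , e∈ , f∈) → n , proj₁ (right e∈) , proj₁ (right f∈)) inW)

  -- All left endpoints precede all right endpoints, so only left with left and right with right
  -- have to be compared: positions and values of a permutation.
  crossing-twins : ∀ m u xs → AllPairs _≢_ xs → All (λ x → lo x ≤ m × m ≤ hi x) xs → 0 < u →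
    (∀ R → R * (R * R) ≤ 8 * (u * u) → 20 * (u * R) ≤ length xs) → TwinsIn xs u
  crossing-twins m u xs unique crosses 0<u enough = collect (permutation-twins u xs unique 0<u enough)
    where
    open Permutation lo hi lo-injective hi-injective

    across : ∀ {x y} → x ∈ xs → y ∈ xs → lo x < hi y
    across {x} {y} x∈ y∈ = ≤∧≢⇒<
      (≤-trans (proj₁ (All.lookup crosses x∈)) (proj₂ (All.lookup crosses y∈)))
      (λ e → <-irrefl (trans e (cong hi (sym (lo≡hi⇒≡ e)))) (lo<hi x))

    hi-≢ : ∀ {x y} → hi x < hi y → x ≢ y
    hi-≢ l refl = <-irrefl refl l

    twin : ∀ {p q} → hi (proj₁ p) < hi (proj₂ p) × proj₁ p ∈ xs × proj₂ p ∈ xs →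
           hi (proj₁ q) < hi (proj₂ q) × proj₁ q ∈ xs × proj₂ q ∈ xs → Compatible p q → Twin p q
    twin (l , e∈ , f∈) (l′ , e′∈ , f′∈) (same , inj₁ s) =
      (same , inj₁ (across e∈ e′∈ , across f∈ f′∈) , inj₂ (across e′∈ e∈ , across f′∈ f∈) ,
       inj₁ (<-trans l s , <-trans s l′)) ,
      hi-≢ (<-trans l (<-trans s l′)) , hi-≢ s
    twin (l , e∈ , f∈) (l′ , e′∈ , f′∈) (same , inj₂ s) =
      (same , inj₁ (across e∈ e′∈ , across f∈ f′∈) , inj₂ (across e′∈ e∈ , across f′∈ f∈) ,
       inj₂ (<-trans l′ s , <-trans s l)) ,
      (λ e → hi-≢ s (sym e)) , (λ e → hi-≢ (<-trans l′ (<-trans s l)) (sym e))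

    collect : ∃[ V ] u < length V × AllPairs Compatible V × All (λ (x , y) → hi x < hi y × x ∈ xs × y ∈ xs) V →
              TwinsIn xs u
    collect (V , u< , compatible , valid) = V , u< , AllPairs-members twin valid compatible ,
      All.map (λ (l , e∈ , f∈) → hi-≢ l , e∈ , f∈) valid

  -- Fewer than a third of the edges lie strictly to the left of m, and at least
  -- a third lie weakly to the left.  Either a third lie to the right of m, or
  -- a third pass over m.
  matching-twins : ∀ u xs → AllPairs _≢_ xs → 2 ≤ length xs → Large u (length xs) → TwinsIn xs u
  matching-twins = <-rec (λ u → ∀ xs → AllPairs _≢_ xs → 2 ≤ length xs → Large u (length xs) → TwinsIn xs u) step
    where
    step : ∀ u → (∀ {v} → v < u → ∀ xs → AllPairs _≢_ xs → 2 ≤ length xs → Large v (length xs) → TwinsIn xs v) →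
           ∀ xs → AllPairs _≢_ xs → 2 ≤ length xs → Large u (length xs) → TwinsIn xs u
    -- Any two single edges are twins of size one.
    step zero rec (x ∷ y ∷ _) ((x≢y ∷ _) ∷ _) _ _ =
      (x , y) ∷ [] , s≤s z≤n , [] ∷ [] , (x≢y , here refl , there (here refl)) ∷ []
    step zero rec (_ ∷ []) _ (s≤s ()) _
    step u@(suc w) rec xs unique _ big with first-step (λ m → n ≤? 3 * length (filter (λ x → hi x <? m) xs)) start bound finish
      where
      n = length xs
      start : ¬ n ≤ 3 * length (filter (λ x → hi x <? 0) xs)
      start le = <⇒≱ (Large⇒0< big) (subst (λ ys → n ≤ 3 * length ys)
        (filter-none (λ x → hi x <? 0) (All.tabulate {xs = xs} λ _ ())) le)
      finish : n ≤ 3 * length (filter (λ x → hi x <? bound) xs)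
      finish = subst (λ ys → n ≤ 3 * length ys)
        (sym (filter-all (λ x → hi x <? bound) (All.tabulate {xs = xs} λ {x} _ → hi<bound x))) (m≤n*m n 3)
    ... | m , few , many = decide (n ≤? 3 * length right)
      where
      n = length xs
      v = ⌊ u /2⌋

      left right notBelow over : List A
      left     = filter (λ x → hi x <? suc m) xs
      right    = filter (λ x → m <? lo x) xs
      notBelow = filter (λ x → ¬? (hi x <? m)) xs
      over     = filter (λ x → ¬? (m <? lo x)) notBelow

      half : ∀ ys → AllPairs _≢_ ys → n ≤ 3 * length ys → TwinsIn ys v
      half ys unique le = rec (⌊n/2⌋<n w) ys unique
        (*-cancelˡ-< 3 1 _ (≤-trans (Large⇒4≤ (s≤s z≤n) big) le))
        (Large-half (≤-trans (+-monoʳ-≤ v (⌊n/2⌋≤⌈n/2⌉ u)) (≤-reflexive (⌊n/2⌋+⌈n/2⌉≡n u))) big le)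

      u≤v+1+v : u ≤ v + suc v
      u≤v+1+v = begin
        u                   ≡⟨ sym (⌊n/2⌋+⌈n/2⌉≡n u) ⟩
        v + ⌊ suc u /2⌋     ≤⟨ +-monoʳ-≤ v (⌊n/2⌋-mono (n≤1+n (suc u))) ⟩
        v + suc v           ∎
        where open ≤-Reasoning

      shrink : TwinsIn xs (v + suc v) → TwinsIn xs u
      shrink (V , l , twins) = V , ≤-<-trans u≤v+1+v l , twins

      -- The edges ending before `m`, those starting after `m` and those in `over` make up `xs`, and
      -- each of the first two kinds has fewer than a third.
      over-large : ¬ n ≤ 3 * length right → n ≤ 3 * length over
      over-large fewRight = ≮⇒≥ λ fewOver → <-irrefl
        (cong (3 *_) (trans (cong (length (filter (λ x → hi x <? m) xs) +_) (length-filter-¬ (λ x → m <? lo x) notBelow))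
                            (length-filter-¬ (λ x → hi x <? m) xs)))
        (begin-strict
          3 * (b + (r + o))        ≡⟨ distribute b r o ⟩
          3 * b + (3 * r + 3 * o)  <⟨ +-mono-< (≰⇒> few) (+-mono-< (≤-<-trans (*-monoʳ-≤ 3 r≤) (≰⇒> fewRight)) fewOver) ⟩
          n + (n + n)              ≡⟨ triple n ⟩
          3 * n                    ∎)
        where
        open ≤-Reasoning
        b = length (filter (λ x → hi x <? m) xs)
        r = length (filter (λ x → m <? lo x) notBelow)
        o = length over
        r≤ : r ≤ length right
        r≤ = length-filter-mono-⊆ (λ x → m <? lo x) (filter-⊆ _ xs)
        distribute : ∀ b r o → 3 * (b + (r + o)) ≡ 3 * b + (3 * r + 3 * o)
        distribute = solve-∀
        triple : ∀ n → n + (n + n) ≡ 3 * n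
        triple = solve-∀

      decide : Dec (n ≤ 3 * length right) → TwinsIn xs u
      decide (yes manyRight) = shrink (union (∈-filter⁻ (λ x → hi x <? suc m) {xs = xs}) (∈-filter⁻ (λ x → m <? lo x) {xs = xs})
        (half left (AllPairs.filter⁺ _ unique) many) (half right (AllPairs.filter⁺ _ unique) manyRight))
      decide (no fewRight) = restore (crossing-twins m u over
        (AllPairs.filter⁺ _ (AllPairs.filter⁺ _ unique))
        (All.tabulate λ x∈ → ≮⇒≥ (proj₂ (∈-filter⁻ (λ x → ¬? (m <? lo x)) {xs = notBelow} x∈)) ,
          ≮⇒≥ (proj₂ (∈-filter⁻ (λ x → ¬? (hi x <? m)) {xs = xs} (proj₁ (∈-filter⁻ (λ x → ¬? (m <? lo x)) {xs = notBelow} x∈)))))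
        (s≤s z≤n) (λ R → Large-third {R = R} big (over-large fewRight)))
        where
        lift : ∀ {x} → x ∈ over → x ∈ xs
        lift x∈ = Any-resp-⊆ (filter-⊆ _ xs) (Any-resp-⊆ (filter-⊆ _ notBelow) x∈)

        restore : TwinsIn over u → TwinsIn xs u
        restore (V , u< , twins , inV) =
          V , u< , twins , All.map (λ (e≢f , e∈ , f∈) → e≢f , lift e∈ , lift f∈) inV

-- From lists of edge pairs to order-isomorphic sub-matchings.

AllPairs-lookup : ∀ {A : Set} {R : A → A → Set} {xs} → AllPairs R xs →
                  ∀ i j → i Fin.< j → R (List.lookup xs i) (List.lookup xs j)
AllPairs-lookup (r ∷ _)  Fin.zero    (Fin.suc j) _       = All.lookup r (∈-lookup j)
AllPairs-lookup (_ ∷ rs) (Fin.suc i) (Fin.suc j) (s≤s l) = AllPairs-lookup rs i j l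

fromList : ∀ {n} → List (Fin n) → Subset n
fromList []       = ⊥
fromList (i ∷ is) = fromList is [ i ]≔ Subset.inside

∈-fromList⁺ : ∀ {n} {is : List (Fin n)} {i} → i ∈ is → i Subset.∈ fromList is
∈-fromList⁺ {is = j ∷ is} (here refl) = []≔-updates (fromList is) j
∈-fromList⁺ {is = j ∷ is} {i} (there i∈) with i Fin.≟ j
... | yes refl = []≔-updates (fromList is) j
... | no  i≢j  = []≔-minimal (fromList is) i j i≢j (∈-fromList⁺ i∈)

∈-fromList⁻ : ∀ {n} (is : List (Fin n)) {i} → i Subset.∈ fromList is → i ∈ is
∈-fromList⁻ []       i∈ = ⊥-elim (∉⊥ i∈)
∈-fromList⁻ (j ∷ is) {i} i∈ with i Fin.≟ j
... | yes refl = here refl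
... | no  i≢j  = there (∈-fromList⁻ is (lookup⇒[]= i (fromList is)
  (trans (sym (lookup∘update′ i≢j (fromList is) Subset.inside)) ([]=⇒lookup i∈))))

∣insert∣ : ∀ {n} (p : Subset n) i → ¬ i Subset.∈ p → ∣ p [ i ]≔ Subset.inside ∣ ≡ suc ∣ p ∣
∣insert∣ (Subset.outside Vec.∷ p) Fin.zero    _  = refl
∣insert∣ (Subset.inside Vec.∷ p) Fin.zero    i∉ = ⊥-elim (i∉ Vec.here)
∣insert∣ (Subset.outside Vec.∷ p) (Fin.suc i) i∉ = ∣insert∣ p i (λ i∈ → i∉ (Vec.there i∈))
∣insert∣ (Subset.inside Vec.∷ p) (Fin.suc i) i∉ = cong suc (∣insert∣ p i (λ i∈ → i∉ (Vec.there i∈)))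

∣fromList∣ : ∀ {n} {is : List (Fin n)} → AllPairs _≢_ is → ∣ fromList is ∣ ≡ length is
∣fromList∣ {n} []               = ∣⊥∣≡0 n
∣fromList∣ {is = i ∷ is} (r ∷ rs) =
  trans (∣insert∣ (fromList is) i (λ i∈ → All.lookup r (∈-fromList⁻ is i∈) refl)) (cong suc (∣fromList∣ rs))

-- Indexing the two sub-matchings by a side lets their common properties be proved once.
data Side : Set where
  one two : Side

other : Side → Side
other one = two
other two = one

side : ∀ {B : Set} → Side → B × B → B
side one = proj₁
side two = proj₂

module Twins {n} (M : OrderedMatching n) where

  left right : Fin n → Fin (2 * n)
  left  e = proj₁ (Vec.lookup (edges M) e)
  right e = proj₂ (Vec.lookup (edges M) e)

  left<right : ∀ e → left e Fin.< right e
  left<right = proj₁ (isMatching M)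

  shared⇒≡ : ∀ {e f x} → x ∈ᵉ Vec.lookup (edges M) e → x ∈ᵉ Vec.lookup (edges M) f → e ≡ f
  shared⇒≡ {e} {f} {x} x∈e x∈f with e Fin.≟ f
  ... | yes e≡f = e≡f
  ... | no  e≢f = ⊥-elim (proj₂ (isMatching M) e f e≢f x (x∈e , x∈f))

  open Matching (λ e → toℕ (left e)) (λ e → toℕ (right e)) left<right
    (λ p → shared⇒≡ (inj₁ refl) (inj₁ (toℕ-injective p)))
    (λ p → shared⇒≡ (inj₂ refl) (inj₂ (toℕ-injective p)))
    (λ p → shared⇒≡ (inj₁ refl) (inj₂ (toℕ-injective p)))
    (2 * n) (λ e → toℕ<n (right e)) public

  Below : Fin (2 * n) × Fin (2 * n) → Fin (2 * n) × Fin (2 * n) → Set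
  Below (x , x′) (y , y′) = x Fin.< y × x′ Fin.< y′

  -- The graph of the isomorphism. Once sorted, its two columns enumerate the two vertex sets in
  -- increasing order.
  vertexPairs : List (Fin n × Fin n) → List (Fin (2 * n) × Fin (2 * n))
  vertexPairs []            = []
  vertexPairs ((e , f) ∷ V) = (left e , left f) ∷ (right e , right f) ∷ vertexPairs V

  left∈ : ∀ {V e f} → (e , f) ∈ V → (left e , left f) ∈ vertexPairs V
  left∈ (here refl) = here refl
  left∈ (there p∈)  = there (there (left∈ p∈))

  right∈ : ∀ {V e f} → (e , f) ∈ V → (right e , right f) ∈ vertexPairs V
  right∈ (here refl) = there (here refl)
  right∈ (there p∈)  = there (there (right∈ p∈))

  Origin : List (Fin n × Fin n) → Fin (2 * n) × Fin (2 * n) → Set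
  Origin V z = ∃[ e ] ∃[ f ] (e , f) ∈ V × (z ≡ (left e , left f) ⊎ z ≡ (right e , right f))

  origin : ∀ {V z} → z ∈ vertexPairs V → Origin V z
  origin {(e , f) ∷ V} (here refl)         = e , f , here refl , inj₁ refl
  origin {(e , f) ∷ V} (there (here refl)) = e , f , here refl , inj₂ refl
  origin {_ ∷ V} (there (there z∈)) with origin z∈
  ... | e , f , p∈ , z≡ = e , f , there p∈ , z≡

  -- The four parts of `Similar` compare the vertices of different pairs; within a pair, left
  -- precedes right on both sides.
  vertexPairs-comparable : ∀ {V} → AllPairs Twin V → AllPairs (λ y z → Below y z ⊎ Below z y) (vertexPairs V)
  vertexPairs-comparable []                 = []
  vertexPairs-comparable (_∷_ {e , f} t ts) =
    (inj₁ (left<right e , left<right f) ∷ expand (λ ((ll , lh , _ , _) , _) → ll , lh) t) ∷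
    expand (λ ((_ , _ , hl , hh) , _) → hl , hh) t ∷
    vertexPairs-comparable ts
    where
    expand : ∀ {y V} → (∀ {p} → Twin (e , f) p →
               (Below y (left (proj₁ p) , left (proj₂ p)) ⊎ Below (left (proj₁ p) , left (proj₂ p)) y) ×
               (Below y (right (proj₁ p) , right (proj₂ p)) ⊎ Below (right (proj₁ p) , right (proj₂ p)) y)) →
             All (Twin (e , f)) V → All (λ z → Below y z ⊎ Below z y) (vertexPairs V)
    expand g []       = []
    expand g (t ∷ ts) = proj₁ (g t) ∷ proj₂ (g t) ∷ expand g ts

  module _ {V : List (Fin n × Fin n)} (twins : AllPairs Twin V)
           (sorted : ∃[ ws ] ws ↭ vertexPairs V × AllPairs Below ws) where

    ws : List (Fin (2 * n) × Fin (2 * n))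
    ws = proj₁ sorted

    chosen : Side → Subset n
    chosen s = fromList (map (side s) V)

    vertices : Side → Vec (Fin (2 * n)) (length ws)
    vertices s = Vec.tabulate λ i → side s (List.lookup ws i)

    lookup-vertices : ∀ s i → Vec.lookup (vertices s) i ≡ side s (List.lookup ws i)
    lookup-vertices s = lookup∘tabulate λ i → side s (List.lookup ws i)

    below-side : ∀ s {y z} → Below y z → side s y Fin.< side s z
    below-side one = proj₁
    below-side two = proj₂

    increasing : ∀ s → StrictlyIncreasing (vertices s)
    increasing s i j i<j rewrite lookup-vertices s i | lookup-vertices s j =
      below-side s (AllPairs-lookup (proj₂ (proj₂ sorted)) i j i<j)

    index : ∀ s {z} → z ∈ vertexPairs V → ∃[ i ] Vec.lookup (vertices s) i ≡ side s z
    index s {z} z∈ = Any.index z∈ws , trans (lookup-vertices s _) (cong (side s) (sym (lookup-index z∈ws)))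
      where
      z∈ws : z ∈ ws
      z∈ws = ∈-resp-↭ (↭-sym (proj₁ (proj₂ sorted))) z∈

    lookup∈ : ∀ i → List.lookup ws i ∈ vertexPairs V
    lookup∈ i = ∈-resp-↭ (proj₁ (proj₂ sorted)) (∈-lookup i)

    chosen⁻ : ∀ s {e} → e Subset.∈ chosen s → ∃[ p ] p ∈ V × e ≡ side s p
    chosen⁻ s e∈ = ∈-map⁻ (side s) (∈-fromList⁻ (map (side s) V) e∈)

    chosen⁺ : ∀ s {p} → p ∈ V → side s p Subset.∈ chosen s
    chosen⁺ s p∈ = ∈-fromList⁺ (∈-map⁺ (side s) p∈)

    side-map : ∀ {B C : Set} s (g : B → C) (p : B × B) → side s (g (proj₁ p) , g (proj₂ p)) ≡ g (side s p)
    side-map one g p = refl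
    side-map two g p = refl

    enumerates : ∀ s → Enumerates (subGraph M (chosen s)) (vertices s)
    enumerates s = increasing s , λ x → mk⇔ to from
      where
      to : ∀ {x} → Vertex (subGraph M (chosen s)) x → ∃[ i ] Vec.lookup (vertices s) i ≡ x
      to (e , e∈ , x∈) with chosen⁻ s e∈
      to (_ , _ , inj₁ refl) | p , p∈ , refl with index s (left∈ p∈)
      ... | i , eq = i , trans eq (side-map s left p)
      to (_ , _ , inj₂ refl) | p , p∈ , refl with index s (right∈ p∈)
      ... | i , eq = i , trans eq (side-map s right p)

      from : ∀ {x} → ∃[ i ] Vec.lookup (vertices s) i ≡ x → Vertex (subGraph M (chosen s)) x
      from (i , refl) with origin (lookup∈ i)
      ... | e , f , p∈ , z≡ = side s (e , f) , chosen⁺ s p∈ , endpoint z≡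
        where
        endpoint : List.lookup ws i ≡ (left e , left f) ⊎ List.lookup ws i ≡ (right e , right f) →
                   Vec.lookup (vertices s) i ∈ᵉ Vec.lookup (edges M) (side s (e , f))
        endpoint (inj₁ z≡) = inj₁ (trans (lookup-vertices s i) (trans (cong (side s) z≡) (side-map s left (e , f))))
        endpoint (inj₂ z≡) = inj₂ (trans (lookup-vertices s i) (trans (cong (side s) z≡) (side-map s right (e , f))))

    -- Distinct vertex pairs differ on both sides.
    transfer : ∀ s {y z} → y ∈ vertexPairs V → z ∈ vertexPairs V → side s y ≡ side s z → side (other s) y ≡ side (other s) z
    transfer s y∈ z∈ eq
      with AllPairs-∈ swap (vertexPairs-comparable twins) y∈ z∈
    ... | inj₁ refl     = refl
    ... | inj₂ (inj₁ b) = ⊥-elim (<-irrefl (cong toℕ eq) (below-side s b))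
    ... | inj₂ (inj₂ b) = ⊥-elim (<-irrefl (cong toℕ (sym eq)) (below-side s b))

    -- A vertex on one side determines its partner, so the partner edge joins the vertices at the
    -- same indices. The two values of `s` give the two directions of the equivalence.
    adjacent : ∀ s i j →
      Adj (subGraph M (chosen s)) (Vec.lookup (vertices s) i) (Vec.lookup (vertices s) j) →
      Adj (subGraph M (chosen (other s))) (Vec.lookup (vertices (other s)) i) (Vec.lookup (vertices (other s)) j)
    adjacent s i j (e , e∈ , joins) with chosen⁻ s e∈
    ... | p , p∈ , refl = side (other s) p , chosen⁺ (other s) p∈ , across joins
      where
      move : (end : Fin n → Fin (2 * n)) → (end (proj₁ p) , end (proj₂ p)) ∈ vertexPairs V → ∀ i →
             Vec.lookup (vertices s) i ≡ end (side s p) → Vec.lookup (vertices (other s)) i ≡ end (side (other s) p)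
      move end end∈ i eq = trans (lookup-vertices (other s) i) (trans
        (transfer s (lookup∈ i) end∈ (trans (sym (lookup-vertices s i)) (trans eq (sym (side-map s end p)))))
        (side-map (other s) end p))

      across : Joins (Vec.lookup (edges M) (side s p)) (Vec.lookup (vertices s) i) (Vec.lookup (vertices s) j) →
               Joins (Vec.lookup (edges M) (side (other s) p))
                     (Vec.lookup (vertices (other s)) i) (Vec.lookup (vertices (other s)) j)
      across (inj₁ (a , b)) = inj₁ (move left (left∈ p∈) i a , move right (right∈ p∈) j b)
      across (inj₂ (a , b)) = inj₂ (move right (right∈ p∈) i a , move left (left∈ p∈) j b)

    orderIsomorphic : OrderIsomorphic (subGraph M (chosen one)) (subGraph M (chosen two))
    orderIsomorphic = length ws , vertices one , vertices two , enumerates one , enumerates two ,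
      λ i j _ → mk⇔ (adjacent one i j) (adjacent two i j)

    ∣chosen∣ : ∀ s → ∣ chosen s ∣ ≡ length V
    ∣chosen∣ s = trans (∣fromList∣ (AllPairs.map⁺ (AllPairs.map (distinct s) twins))) (length-map (side s) V)
      where
      distinct : ∀ s {p q} → Twin p q → side s p ≢ side s q
      distinct one ((inj₁ (l , _) , _) , _) eq = <-irrefl (cong (λ e → toℕ (left e)) eq) l
      distinct one ((inj₂ (l , _) , _) , _) eq = <-irrefl (cong (λ e → toℕ (left e)) (sym eq)) l
      distinct two ((inj₁ (_ , l) , _) , _) eq = <-irrefl (cong (λ e → toℕ (left e)) eq) l
      distinct two ((inj₂ (_ , l) , _) , _) eq = <-irrefl (cong (λ e → toℕ (left e)) (sym eq)) l

    -- A common edge would be first in one pair and second in the same or in another pair; `e ≢ f`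
    -- excludes the former and `Twin` the latter.
    chosen-disjoint : All (λ (e , f) → e ≢ f) V → Empty (chosen one ∩ chosen two)
    chosen-disjoint e≢f (x , x∈) with x∈p∩q⁻ (chosen one) (chosen two) x∈
    ... | x∈₁ , x∈₂ with chosen⁻ one x∈₁ | chosen⁻ two x∈₂
    ... | p , p∈ , refl | q , q∈ , eq with AllPairs-∈ Twin-sym twins p∈ q∈
    ... | inj₁ refl           = All.lookup e≢f p∈ eq
    ... | inj₂ (_ , e≢f′ , _) = e≢f′ eq

  hasTwins : ∀ {V} → AllPairs Twin V → All (λ (e , f) → e ≢ f) V → HasTwinsOfSize M (length V)
  hasTwins {V} twins e≢f =
    chosen twins sorted one , chosen twins sorted two , chosen-disjoint twins sorted e≢f ,
    ∣chosen∣ twins sorted one , ∣chosen∣ twins sorted two , orderIsomorphic twins sorted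
    where
    sorted : ∃[ ws ] ws ↭ vertexPairs V × AllPairs Below ws
    sorted = linearise (λ (a , b) (c , d) → <-trans a c , <-trans b d) (vertexPairs-comparable twins)

-- The bound is raised to the fifth power, (n/4)^3 ≤ (8t)^5, and cleared of fractions. Its failure
-- makes a matching attaining the minimum `Large`, which yields twins larger than its maximum.
corollary19 : ∀ (n : ℕ) → 2 ≤ n → n ^ 3 ≤ 4 ^ 3 * (8 * t₂ᵐᵃᵗᶜʰ n) ^ 5
corollary19 n 2≤n with t₂ᵐᵃᵗᶜʰ-isMinimum n
... | (M , t₂M≡t) , _ = ≮⇒≥ λ exceeds → contradict
  (matching-twins (t₂ᵐᵃᵗᶜʰ n) (allFin n) (Unique.allFin⁺ n)
    (subst (2 ≤_) (sym length-allFin) 2≤n) (subst (Large (t₂ᵐᵃᵗᶜʰ n)) (sym length-allFin) (large exceeds)))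
  where
  open Twins M

  length-allFin : length (allFin n) ≡ n
  length-allFin = length-tabulate (λ i → i)

  contradict : ¬ TwinsIn (allFin n) (t₂ᵐᵃᵗᶜʰ n)
  contradict (V , t< , twins , valid) = <⇒≱ t< (subst (length V ≤_) t₂M≡t
    (proj₂ (t₂-isMaximum M) _ (hasTwins twins (All.map proj₁ valid))))
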